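{- Let $n\ge7$ be odd, let $s$ be an integer with $1\le s\le n$ and $\gcd(s,n)=1$, and let \[ \mathcal{S}_{n,n-4,s}=\Bigl\{b_0X+\sum_{i=1}^{2}\bigl(b_iX^{q^{si}}+(b_iX)^{q^{s(n-i)}}\bigr): b_0,b_1,b_2\in\mathbb{F}_{q^n}\Bigr\}. \] Let $\rho$ be the rank function of the $q$-polymatroid $\mathcal{M}[\mathcal{S}_{n,n-4,s}]$. Then for every $u$-dimensional $\mathbb{F}_q$-subspace $U$ of $\mathbb{F}_{q^n}$: $\rho(U)=3n$ if $u>4$; $\rho(U)=\frac{u(2n-u+1)}{2}$ if $u<4$; and $\rho(U)\in\{3n,3n-1\}$ if $u=4$.
   Context: Each $q^s$-polynomial $f=\sum_{i=0}^{n-1}a_iX^{q^{si}}$ with $a_i\in\mathbb{F}_{q^n}$ defines an $\mathbb{F}_q$-linear map $x\mapsto f(x)$ of $\mathbb{F}_{q^n}$; identifying $\mathbb{F}_{q^n}$ with $\mathbb{F}_q^n$ via a suitable $\mathbb{F}_q$-basis, $\mathcal{S}_{n,n-4,s}$ becomes an $\mathbb{F}_q$-linear space of symmetric $n\times n$ matrices over $\mathbb{F}_q$ (of $\mathbb{F}_q$-dimension $3n$ and minimum rank distance $n-4$). The $q$-polymatroid $\mathcal{M}[\mathcal{C}]$ of such a code is its column $q$-polymatroid; in this polynomial setting its rank function on $\mathbb{F}_q$-subspaces $U\le\mathbb{F}_{q^n}$ is $\rho(U)=\dim_{\mathbb{F}_q}\mathcal{C}-\dim_{\mathbb{F}_q}\{f\in\mathcal{C}: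 f(x)=0\ \text{for all } x\in U\}$. -}

module Defs where

open import Data.Nat as ℕ using (ℕ; zero; suc; _∸_; _^_; _≤_)
open import Data.Nat.Primality using (Prime)
open import Data.Fin using (Fin)
open import Data.List using (List; map; length; filterᵇ; foldr; cartesianProduct; allFin)
open import Data.Bool using (Bool; not; _∨_)
open import Data.Product using (_×_; _,_; ∃-syntax)
open import Relation.Binary.PropositionalEquality using (_≡_; _≢_)
open import Relation.Binary.Definitions using (DecidableEquality)
open import Relation.Unary using (Pred; Decidable)
open import Relation.Nullary.Decidable using (⌊_⌋)
open import Function.Bundles using (_↔_; Inverse)
open import Algebra.Structures using (IsCommutativeRing)
open import Level using (0ℓ)

IsPrimePower : ℕ → Set
IsPrimePower q = ∃[ p ] ∃[ e ] (Prime p × 1 ≤ e × q ≡ p ^ e)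

record FiniteField (q n : ℕ) : Set₁ where
  infixl 6 _+_
  infixl 7 _*_
  field
    Carrier : Set
    _+_ _*_ : Carrier → Carrier → Carrier
    -_      : Carrier → Carrier
    0# 1#   : Carrier
    isCommutativeRing : IsCommutativeRing _≡_ _+_ _*_ -_ 0# 1#
    0≢1     : 0# ≢ 1#
    inverse : ∀ x → x ≢ 0# → ∃[ y ] (x * y ≡ 1#)
    _≟_     : DecidableEquality Carrier
    enum    : Fin (q ^ n) ↔ Carrier

  pow : Carrier → ℕ → Carrier
  pow x zero    = 1#
  pow x (suc k) = x * pow x k

  frob : ℕ → Carrier → Carrier
  frob k x = pow x (q ^ k)

  InFq : Carrier → Set
  InFq c = pow c q ≡ c

  elems : List Carrier
  elems = map (Inverse.to enum) (allFin (q ^ n))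

  count : {P : Pred Carrier 0ℓ} → Decidable P → ℕ
  count P? = length (filterᵇ (λ x → ⌊ P? x ⌋) elems)

-- U is an F_q-subspace of F_{q^n} of F_q-dimension u (|U| = q^u)
record Subspace {q n : ℕ} (K : FiniteField q n) (u : ℕ) : Set₁ where
  open FiniteField K
  field
    U     : Pred Carrier 0ℓ
    U?    : Decidable U
    zero∈ : U 0#
    +∈    : ∀ {x y} → U x → U y → U (x + y)
    scal∈ : ∀ {c x} → InFq c → U x → U (c * x)
    card  : count U? ≡ q ^ u

module _ {q n : ℕ} (K : FiniteField q n) where
  open FiniteField K

  polyS : ℕ → Carrier × Carrier × Carrier → Carrier → Carrier
  polyS s (b0 , b1 , b2) x =
    b0 * x
    + (b1 * frob (s ℕ.* 1) x + frob (s ℕ.* (n ∸ 1)) (b1 * x))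
    + (b2 * frob (s ℕ.* 2) x + frob (s ℕ.* (n ∸ 2)) (b2 * x))

  kerCount : ∀ {u} → ℕ → Subspace K u → ℕ
  kerCount s W = length (filterᵇ vanishes triples)
    where
      open Subspace W
      triples : List (Carrier × Carrier × Carrier)
      triples = cartesianProduct elems (cartesianProduct elems elems)
      vanishes : Carrier × Carrier × Carrier → Bool
      vanishes b = foldr (λ x acc → acc Data.Bool.∧ ( not ⌊ U? x ⌋ ∨ ⌊ polyS s b x ≟ 0# ⌋)) Data.Bool.true elems

  -- ρ(U) = r for the q-polymatroid M[S_{n,n-4,s}]:
  -- ρ(U) = dim C - dim C_U = 3n - dim_Fq {(b0,b1,b2) : f_b vanishes on U},
  -- and dim_Fq of that F_q-space is d where its size is q^d.
  RankIs : ∀ {u} → ℕ → Subspace K u → ℕ → Set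
  RankIs s W r = ∃[ d ] (kerCount s W ≡ q ^ d × d ℕ.+ r ≡ 3 ℕ.* n)

{-# OPTIONS --safe #-}
module Submission where

-- With σ x = x^(q^s), a generator of the Galois group, and τ = σ⁻¹, the polynomial of (b₀ , b₁ , b₂) is
-- F x = b₀ x + b₁ σ x + τ (b₁ x) + b₂ σ² x + τ² (b₂ x).  As σ² ∘ F is a polynomial of degree at most 4 in σ,
-- it is zero once it vanishes on five independent elements.  If F and F′ vanish on the same four independent
-- elements, comparing leading coefficients gives σ² F′ = σ²(c) σ² F, and the lowest coefficients b₂ and b₂′
-- then give c = σ² c, so c ∈ F_q because n is odd: the kernel has dimension 0 or 1.
-- For u < 4 rescale so that 1 ∈ U.  The root 1 determines b₀, and then, with Y = σ y − y,
-- F y = (1 − τ)(b₁ Y + b₂ (σ Y + Y) + τ b₂ (Y + τ Y)), so that F y = 0 says that the argument of 1 − τ is a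
-- scalar.  For one y this equation is solved for b₁; for two, eliminating b₁ leaves an equation of the same
-- kind that is solved for b₂.

open import Defs
open import Data.Nat using (ℕ; zero; suc; _+_; _*_; _∸_; _^_; _≤_; _<_; _%_; _/_; z≤n; s≤s; _!; nonTrivial⇒n>1; >-nonZero)
open import Data.Nat.GCD using (gcd; module Bézout)
open import Data.Sum using (_⊎_; inj₁; inj₂)
open import Data.Product using (_×_; _,_; proj₁; proj₂; ∃-syntax)
open import Relation.Binary.PropositionalEquality using (_≡_; _≢_; refl; sym; trans; cong; cong₂; subst; setoid; module ≡-Reasoning)
open import Algebra.Bundles using (CommutativeRing; RawRing)
open import Algebra.Solver.Ring.AlmostCommutativeRing using (fromCommutativeRing; _-Raw-AlmostCommutative⟶_)
open import Data.Bool using (Bool; true; T; T?; _∧_; _∨_; not)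
open import Data.Empty using (⊥; ⊥-elim)
import Data.Fin as Fin
import Data.Fin.Properties as Finₚ
open import Data.List using (List; []; _∷_; map; length; filter; foldr; cartesianProduct; _++_; replicate; allFin; zipWith)
open import Data.List.Properties using (length-map; length-++; length-tabulate; length-replicate)
open import Data.List.Membership.Propositional using (_∈_; _∉_)
open import Data.List.Membership.Propositional.Properties using (∈-map⁺; ∈-map⁻; ∈-++⁻; ∈-++⁺ˡ; ∈-++⁺ʳ; ∈-∃++; ∈-allFin; ∈-filter⁺; ∈-filter⁻; ∈-cartesianProduct⁺; ∈-cartesianProduct⁻)
open import Data.List.Membership.Propositional.Properties.WithK using (unique∧set⇒bag)
open import Data.List.Relation.Binary.BagAndSetEquality using (∼bag⇒↭)
open import Data.List.Relation.Binary.Permutation.Propositional using (_↭_; ↭⇒↭ₛ)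
open import Data.List.Relation.Binary.Permutation.Setoid.Properties using (foldr-commMonoid)
open import Data.List.Relation.Unary.All as All using (All; []; _∷_)
open import Data.List.Relation.Unary.AllPairs using ([]; _∷_)
open import Data.List.Relation.Unary.Any using (here; there)
open import Data.List.Relation.Unary.Unique.Propositional using (Unique)
import Data.List.Relation.Unary.Unique.Propositional.Properties as Uniqueₚ
open import Data.Maybe using (Maybe; just; nothing)
open import Data.Nat.Combinatorics using (_C_; nCn≡1; nCk≡n!/k![n-k]!; k![n∸k]!∣n!)
open import Data.Nat.Coprimality using (gcd≡1⇒coprime; coprime-Bézout)
open import Data.Nat.DivMod using (m/n*n≡m; m≡m%n+[m/n]*n; m*n/n≡m)
open import Data.Nat.Divisibility using (_∣_; divides; ∣⇒≤; m∣m*n)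
open import Data.Nat.Primality using (Prime; prime⇒nonTrivial; euclidsLemma)
import Data.Nat.Properties as ℕₚ
open import Data.Nat.Tactic.RingSolver using (solve-∀)
open import Data.Product.Properties using (≡-dec)
open import Data.Unit using (tt)
open import Function using (_∘_; mk⇔)
open import Function.Bundles using (Inverse)
open import Level using (Level; 0ℓ)
open import Relation.Binary.Definitions using (DecidableEquality)
open import Relation.Nullary using (Dec; ¬_; yes; no; ¬?; contradiction)
open import Relation.Nullary.Decidable using (⌊_⌋; toWitness; fromWitness)
open import Relation.Unary using (Decidable)

-- The shape of ρ for u < 4 comes from symmetry. F is self-adjoint for the trace form, the adjoint
-- of x ↦ b σ x being x ↦ τ (b x). Once F vanishes on k independent elements, all its values are
-- orthogonal to them, so the next root costs n - k conditions instead of n, and the sum of n - k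
-- over k < u is u(2n - u + 1)/2. The factor 1 - τ makes one such orthogonality explicit: with 1 a
-- root, F y has trace zero. Each scalar left free is one condition saved. What needs proof is that
-- the remaining conditions are independent. This is done by counting: for u = 0, 1, 2, 3 the kernel
-- is put in bijection with a list of size q^(3n), q^(2n), q^(n+1), q^3. At u = 4 the sum 4n - 6
-- exceeds 3n, and the degree of σ² F takes over. The field is given by its axioms and its
-- cardinality alone, so its characteristic, the additivity of Frobenius and |F_q| = q are
-- themselves derived by counting.

private variable
  ℓ₁ ℓ₂ : Level
  A : Set ℓ₁
  B : Set ℓ₂

-- Counting with duplicate-free lists

length-cartesianProduct : (xs : List A) (ys : List B) →
  length (cartesianProduct xs ys) ≡ length xs * length ys
length-cartesianProduct []       ys = refl
length-cartesianProduct (x ∷ xs) ys =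
  trans (length-++ (map (x ,_) ys))
        (cong₂ _+_ (length-map (x ,_) ys) (length-cartesianProduct xs ys))

-- Injectivity is asked on members only, because coordinate maps are injective only while their
-- coefficients are scalars.
unique-map : {f : A → B} {xs : List A} →
  (∀ {x y} → x ∈ xs → y ∈ xs → f x ≡ f y → x ≡ y) → Unique xs → Unique (map f xs)
unique-map inj [] = []
unique-map {f = f} {xs = x ∷ xs} inj (x∉ ∷ u) =
  all-map (λ y∈ → inj (here refl) (there y∈)) x∉ ∷ unique-map (λ p r → inj (there p) (there r)) u
  where
  all-map : ∀ {ys} → (∀ {y} → y ∈ ys → f x ≡ f y → x ≡ y) → All (x ≢_) ys → All (f x ≢_) (map f ys)
  all-map g []       = []
  all-map g (p ∷ ps) = (p ∘ g (here refl)) ∷ all-map (g ∘ there) ps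

unique-⊆⇒length-≤ : {xs ys : List A} → Unique xs → (∀ {x} → x ∈ xs → x ∈ ys) → length xs ≤ length ys
unique-⊆⇒length-≤ [] _ = z≤n
unique-⊆⇒length-≤ {xs = x ∷ xs} (x∉ ∷ u) sub with ∈-∃++ (sub (here refl))
-- Pigeonhole by deletion: the occurrence of `x` is cut out of `ys`, and the other members of `xs`
-- survive in what is left.
... | ys₁ , ys₂ , refl = begin
  suc (length xs)               ≤⟨ s≤s (unique-⊆⇒length-≤ u sub′) ⟩
  suc (length (ys₁ ++ ys₂))     ≡⟨ cong suc (length-++ ys₁) ⟩
  suc (length ys₁ + length ys₂) ≡⟨ ℕₚ.+-suc (length ys₁) (length ys₂) ⟨
  length ys₁ + suc (length ys₂) ≡⟨ length-++ ys₁ ⟨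
  length (ys₁ ++ x ∷ ys₂)       ∎
  where
  open ℕₚ.≤-Reasoning
  sub′ : ∀ {z} → z ∈ xs → z ∈ ys₁ ++ ys₂
  sub′ z∈ with ∈-++⁻ ys₁ (sub (there z∈))
  ... | inj₁ p           = ∈-++⁺ˡ p
  ... | inj₂ (here refl) = ⊥-elim (All.lookup x∉ z∈ refl)
  ... | inj₂ (there p)   = ∈-++⁺ʳ ys₁ p

unique-≋⇒length-≡ : {xs ys : List A} → Unique xs → Unique ys →
  (∀ {x} → x ∈ xs → x ∈ ys) → (∀ {x} → x ∈ ys → x ∈ xs) → length xs ≡ length ys
unique-≋⇒length-≡ ux uy f g = ℕₚ.≤-antisym (unique-⊆⇒length-≤ ux f) (unique-⊆⇒length-≤ uy g)

module _ (_≟_ : DecidableEquality A) where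

  open import Data.List.Membership.DecPropositional _≟_ using (_∈?_)

  ⊆-or-outside : (xs ys : List A) → (∀ {x} → x ∈ xs → x ∈ ys) ⊎ (∃[ x ] (x ∈ xs × x ∉ ys))
  ⊆-or-outside [] ys = inj₁ λ ()
  ⊆-or-outside (x ∷ xs) ys with x ∈? ys | ⊆-or-outside xs ys
  ... | no x∉  | _ = inj₂ (x , here refl , x∉)
  ... | yes _  | inj₂ (y , y∈ , y∉) = inj₂ (y , there y∈ , y∉)
  ... | yes x∈ | inj₁ sub = inj₁ λ { (here refl) → x∈ ; (there p) → sub p }

  element-outside : {xs ys : List A} → Unique xs → length ys < length xs → ∃[ x ] (x ∈ xs × x ∉ ys)
  element-outside {xs} {ys} u lt with ⊆-or-outside xs ys
  ... | inj₁ sub = ⊥-elim (ℕₚ.<⇒≱ lt (unique-⊆⇒length-≤ u sub))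
  ... | inj₂ r   = r

  -- A missing member could be put in front of `ys`, giving a duplicate-free list inside `xs` that
  -- is longer than `xs`.
  full-length⇒⊇ : {xs ys : List A} → Unique ys → (∀ {x} → x ∈ ys → x ∈ xs) → length xs ≤ length ys →
    ∀ {x} → x ∈ xs → x ∈ ys
  full-length⇒⊇ {xs} {ys} u sub le {x} x∈ with x ∈? ys
  ... | yes p = p
  ... | no x∉ = ⊥-elim (ℕₚ.<⇒≱ (unique-⊆⇒length-≤ x∷ys-unique x∷ys⊆xs) le)
    where
    x∷ys-unique : Unique (x ∷ ys)
    x∷ys-unique = All.tabulate (λ { y∈ refl → x∉ y∈ }) ∷ u
    x∷ys⊆xs : ∀ {z} → z ∈ x ∷ ys → z ∈ xs
    x∷ys⊆xs (here refl) = x∈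
    x∷ys⊆xs (there p)   = sub p

-- Binomial coefficients modulo a prime

∤-! : ∀ {p} → Prime p → ∀ m → m < p → ¬ p ∣ m !
∤-! {p} pp zero m<p d =
  ℕₚ.<⇒≱ (nonTrivial⇒n>1 p {{prime⇒nonTrivial pp}}) (∣⇒≤ d)
∤-! {p} pp (suc m) m<p d with euclidsLemma (suc m) (m !) pp d
... | inj₁ p∣m+1 = ℕₚ.<⇒≱ m<p (∣⇒≤ p∣m+1)
... | inj₂ p∣m!  = ∤-! pp m (ℕₚ.<-trans (ℕₚ.n<1+n m) m<p) p∣m!

-- The prime divides p! = C(p,k) · k! (p - k)!, but neither factorial on the right, as all their
-- factors are smaller than p.
prime∣C : ∀ {p} → Prime p → ∀ k → 0 < k → k < p → p ∣ p C k
prime∣C {p} pp k 0<k k<p with euclidsLemma (p C k) (k ! * (p ∸ k) !) pp p∣prod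
  where
  k≤p = ℕₚ.<⇒≤ k<p
  instance
    _ = k ℕₚ.!* (p ∸ k) !≢0
  prod≡ : (p C k) * (k ! * (p ∸ k) !) ≡ p !
  prod≡ = trans (cong (_* (k ! * (p ∸ k) !)) (nCk≡n!/k![n-k]! k≤p)) (m/n*n≡m (k![n∸k]!∣n! k≤p))
  p∣p! : ∀ m → 0 < m → m ∣ m !
  p∣p! (suc m) _ = m∣m*n (m !)
  p∣prod : p ∣ (p C k) * (k ! * (p ∸ k) !)
  p∣prod = subst (p ∣_) (sym prod≡) (p∣p! p (ℕₚ.<-trans 0<k k<p))
... | inj₁ d = d
... | inj₂ d with euclidsLemma (k !) ((p ∸ k) !) pp d
...   | inj₁ d₁ = ⊥-elim (∤-! pp k k<p d₁)
...   | inj₂ d₂ = ⊥-elim (∤-! pp (p ∸ k) (ℕₚ.∸-monoʳ-< 0<k (ℕₚ.<⇒≤ k<p)) d₂)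

-- Arithmetic of a finite field: Fermat's identity and the additivity of Frobenius

module FieldTheory {q n : ℕ} (K : FiniteField q n) where

  open FiniteField K public renaming (_+_ to _⊕_; _*_ to _⊗_; -_ to ⊖_)

  commutativeRing : CommutativeRing 0ℓ 0ℓ
  commutativeRing = record { isCommutativeRing = isCommutativeRing }

  open CommutativeRing commutativeRing public
    using (+-comm; +-assoc; +-identityˡ; +-identityʳ; *-comm; *-assoc; *-identityˡ; *-identityʳ; zeroˡ; zeroʳ; distribˡ; distribʳ; -‿inverseʳ)
  open CommutativeRing commutativeRing using (semiring; ring; +-abelianGroup; +-commutativeSemigroup; commutativeSemiring)

  open import Algebra.Properties.Ring ring using (-‿distribˡ-*; -‿distribʳ-*)
  open import Algebra.Properties.AbelianGroup +-abelianGroup using (⁻¹-∙-comm; ⁻¹-involutive; identityʳ-unique)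
  open import Algebra.Properties.CommutativeSemigroup +-commutativeSemigroup using (interchange)
  open import Algebra.Properties.Semiring.Mult semiring using (×-homo-+; ×1-homo-*; ×-assocˡ; ×-assoc-*) renaming (_×_ to _·_)

  -- The ring solver needs coefficients in which 1 − 1 computes to 0: formal differences a − b of naturals.
  private
    ⟦_⟧ᶜ : ℕ × ℕ → Carrier
    ⟦ a , b ⟧ᶜ = (a · 1#) ⊕ ⊖ (b · 1#)

    difference : RawRing 0ℓ 0ℓ
    difference = record
      { Carrier = ℕ × ℕ
      ; _≈_ = _≡_
      ; _+_ = λ { (a , b) (c , d) → a + c , b + d }
      ; _*_ = λ { (a , b) (c , d) → a * c + b * d , a * d + b * c }
      ; -_  = λ { (a , b) → b , a }
      ; 0#  = 0 , 0
      ; 1#  = 1 , 0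
      }

    open ≡-Reasoning

    diff-+ : ∀ w x y z → (w ⊕ y) ⊕ ⊖ (x ⊕ z) ≡ (w ⊕ ⊖ x) ⊕ (y ⊕ ⊖ z)
    diff-+ w x y z = trans (cong ((w ⊕ y) ⊕_) (sym (⁻¹-∙-comm x z))) (interchange w y (⊖ x) (⊖ z))

    diff-* : ∀ w x y z → (w ⊗ y ⊕ x ⊗ z) ⊕ ⊖ (w ⊗ z ⊕ x ⊗ y) ≡ (w ⊕ ⊖ x) ⊗ (y ⊕ ⊖ z)
    diff-* w x y z = begin
      (w ⊗ y ⊕ x ⊗ z) ⊕ ⊖ (w ⊗ z ⊕ x ⊗ y)                  ≡⟨ diff-+ (w ⊗ y) (w ⊗ z) (x ⊗ z) (x ⊗ y) ⟩
      (w ⊗ y ⊕ ⊖ (w ⊗ z)) ⊕ (x ⊗ z ⊕ ⊖ (x ⊗ y))           ≡⟨ cong₂ _⊕_ (left w) right ⟩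
      w ⊗ (y ⊕ ⊖ z) ⊕ (⊖ x) ⊗ (y ⊕ ⊖ z)                   ≡⟨ distribʳ (y ⊕ ⊖ z) w (⊖ x) ⟨
      (w ⊕ ⊖ x) ⊗ (y ⊕ ⊖ z)                               ∎
      where
      left : ∀ v → v ⊗ y ⊕ ⊖ (v ⊗ z) ≡ v ⊗ (y ⊕ ⊖ z)
      left v = trans (cong (v ⊗ y ⊕_) (-‿distribʳ-* v z)) (sym (distribˡ v y (⊖ z)))
      right : x ⊗ z ⊕ ⊖ (x ⊗ y) ≡ (⊖ x) ⊗ (y ⊕ ⊖ z)
      right = begin
        x ⊗ z ⊕ ⊖ (x ⊗ y)              ≡⟨ +-comm _ _ ⟩
        ⊖ (x ⊗ y) ⊕ x ⊗ z              ≡⟨ cong₂ _⊕_ (-‿distribˡ-* x y) (sym (⁻¹-involutive (x ⊗ z))) ⟩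
        (⊖ x) ⊗ y ⊕ ⊖ (⊖ (x ⊗ z))      ≡⟨ cong (λ t → (⊖ x) ⊗ y ⊕ ⊖ t) (-‿distribˡ-* x z) ⟩
        (⊖ x) ⊗ y ⊕ ⊖ ((⊖ x) ⊗ z)      ≡⟨ left (⊖ x) ⟩
        (⊖ x) ⊗ (y ⊕ ⊖ z)              ∎

    morphism : difference -Raw-AlmostCommutative⟶ fromCommutativeRing commutativeRing
    morphism = record
      { ⟦_⟧    = ⟦_⟧ᶜ
      ; +-homo = λ { (a , b) (c , d) → trans
          (cong₂ (λ s t → s ⊕ ⊖ t) (×-homo-+ 1# a c) (×-homo-+ 1# b d))
          (diff-+ (a · 1#) (b · 1#) (c · 1#) (d · 1#)) }
      ; *-homo = λ { (a , b) (c , d) → trans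
          (cong₂ (λ s t → s ⊕ ⊖ t)
            (trans (×-homo-+ 1# (a * c) (b * d)) (cong₂ _⊕_ (×1-homo-* a c) (×1-homo-* b d)))
            (trans (×-homo-+ 1# (a * d) (b * c)) (cong₂ _⊕_ (×1-homo-* a d) (×1-homo-* b c))))
          (diff-* (a · 1#) (b · 1#) (c · 1#) (d · 1#)) }
      ; -‿homo = λ { (a , b) → trans (+-comm (b · 1#) (⊖ (a · 1#)))
          (trans (cong (⊖ (a · 1#) ⊕_) (sym (⁻¹-involutive (b · 1#)))) (⁻¹-∙-comm (a · 1#) (⊖ (b · 1#)))) }
      ; 0-homo = -‿inverseʳ 0#
      ; 1-homo = trans (cong₂ _⊕_ (+-identityʳ 1#) ⊖0≡0) (+-identityʳ 1#)
      }
      where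
      ⊖0≡0 : ⊖ 0# ≡ 0#
      ⊖0≡0 = trans (sym (+-identityˡ (⊖ 0#))) (-‿inverseʳ 0#)

    -- Equality is tested as a + d = c + b in ℕ. A failed test decides nothing, since the
    -- characteristic identifies further differences.
    _coeff≟_ : (x y : ℕ × ℕ) → Maybe (⟦ x ⟧ᶜ ≡ ⟦ y ⟧ᶜ)
    (a , b) coeff≟ (c , d) with a + d ℕₚ.≟ c + b
    ... | no _   = nothing
    ... | yes eq = just (begin
      α ⊕ ⊖ β                      ≡⟨ cong (_⊕ ⊖ β) (sym (+-identityʳ α)) ⟩
      (α ⊕ 0#) ⊕ ⊖ β               ≡⟨ cong (λ t → (α ⊕ t) ⊕ ⊖ β) (sym (-‿inverseʳ δ)) ⟩
      (α ⊕ (δ ⊕ ⊖ δ)) ⊕ ⊖ β        ≡⟨ cong (_⊕ ⊖ β) (sym (+-assoc α δ (⊖ δ))) ⟩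
      ((α ⊕ δ) ⊕ ⊖ δ) ⊕ ⊖ β        ≡⟨ cong (λ t → (t ⊕ ⊖ δ) ⊕ ⊖ β) α+δ≡γ+β ⟩
      ((γ ⊕ β) ⊕ ⊖ δ) ⊕ ⊖ β        ≡⟨ +-assoc (γ ⊕ β) (⊖ δ) (⊖ β) ⟩
      (γ ⊕ β) ⊕ (⊖ δ ⊕ ⊖ β)        ≡⟨ interchange γ β (⊖ δ) (⊖ β) ⟩
      (γ ⊕ ⊖ δ) ⊕ (β ⊕ ⊖ β)        ≡⟨ cong ((γ ⊕ ⊖ δ) ⊕_) (-‿inverseʳ β) ⟩
      (γ ⊕ ⊖ δ) ⊕ 0#               ≡⟨ +-identityʳ _ ⟩
      γ ⊕ ⊖ δ                      ∎)
      where
      α = a · 1#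
      β = b · 1#
      γ = c · 1#
      δ = d · 1#
      α+δ≡γ+β : α ⊕ δ ≡ γ ⊕ β
      α+δ≡γ+β = trans (sym (×-homo-+ 1# a d)) (trans (cong (_· 1#) eq) (×-homo-+ 1# c b))

  open import Algebra.Solver.Ring difference (fromCommutativeRing commutativeRing) morphism _coeff≟_ public
    using (solve; _:+_; _:*_; :-_; _:-_; _:=_)

  infixl 6 _⊝_
  _⊝_ : Carrier → Carrier → Carrier
  x ⊝ y = x ⊕ ⊖ y

  x⊝y≡0⇒x≡y : ∀ {x y} → x ⊝ y ≡ 0# → x ≡ y
  x⊝y≡0⇒x≡y {x} {y} eq = trans (solve 2 (λ x y → x := (x :- y) :+ y) refl x y) (trans (cong (_⊕ y) eq) (+-identityˡ y))

  x≡y⇒x⊝y≡0 : ∀ {x y} → x ≡ y → x ⊝ y ≡ 0#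
  x≡y⇒x⊝y≡0 {x} refl = -‿inverseʳ x

  inv : ∀ {x} → x ≢ 0# → Carrier
  inv {x} x≢0 = proj₁ (inverse x x≢0)

  inv-inverseʳ : ∀ {x} (x≢0 : x ≢ 0#) → x ⊗ inv x≢0 ≡ 1#
  inv-inverseʳ {x} x≢0 = proj₂ (inverse x x≢0)

  inv-inverseˡ : ∀ {x} (x≢0 : x ≢ 0#) → inv x≢0 ⊗ x ≡ 1#
  inv-inverseˡ x≢0 = trans (*-comm _ _) (inv-inverseʳ x≢0)

  ⊗-cancelˡ : ∀ {x y z} → x ≢ 0# → x ⊗ y ≡ x ⊗ z → y ≡ z
  ⊗-cancelˡ {x} {y} {z} x≢0 eq = begin
    y                     ≡⟨ *-identityˡ y ⟨
    1# ⊗ y                ≡⟨ cong (_⊗ y) (inv-inverseˡ x≢0) ⟨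
    (inv x≢0 ⊗ x) ⊗ y     ≡⟨ *-assoc _ _ _ ⟩
    inv x≢0 ⊗ (x ⊗ y)     ≡⟨ cong (inv x≢0 ⊗_) eq ⟩
    inv x≢0 ⊗ (x ⊗ z)     ≡⟨ *-assoc _ _ _ ⟨
    (inv x≢0 ⊗ x) ⊗ z     ≡⟨ cong (_⊗ z) (inv-inverseˡ x≢0) ⟩
    1# ⊗ z                ≡⟨ *-identityˡ z ⟩
    z                     ∎

  integral : ∀ {x y} → x ⊗ y ≡ 0# → x ≡ 0# ⊎ y ≡ 0#
  integral {x} {y} eq with x ≟ 0#
  ... | yes x≡0 = inj₁ x≡0
  ... | no x≢0  = inj₂ (⊗-cancelˡ x≢0 (trans eq (sym (zeroʳ x))))

  ⊗-≢0 : ∀ {x y} → x ≢ 0# → y ≢ 0# → x ⊗ y ≢ 0#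
  ⊗-≢0 x≢0 y≢0 eq with integral eq
  ... | inj₁ p = x≢0 p
  ... | inj₂ p = y≢0 p

  inv-≢0 : ∀ {x} (x≢0 : x ≢ 0#) → inv x≢0 ≢ 0#
  inv-≢0 {x} x≢0 eq = 0≢1 (trans (sym (zeroʳ x)) (trans (cong (x ⊗_) (sym eq)) (inv-inverseʳ x≢0)))

  pow-+ : ∀ x a b → pow x (a + b) ≡ pow x a ⊗ pow x b
  pow-+ x zero    b = sym (*-identityˡ _)
  pow-+ x (suc a) b = trans (cong (x ⊗_) (pow-+ x a b)) (sym (*-assoc x _ _))

  pow-⊗ : ∀ x y k → pow (x ⊗ y) k ≡ pow x k ⊗ pow y k
  pow-⊗ x y zero    = sym (*-identityˡ 1#)
  pow-⊗ x y (suc k) = trans (cong ((x ⊗ y) ⊗_) (pow-⊗ x y k))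
    (solve 4 (λ x y a b → (x :* y) :* (a :* b) := (x :* a) :* (y :* b)) refl x y (pow x k) (pow y k))

  pow-1 : ∀ k → pow 1# k ≡ 1#
  pow-1 zero    = refl
  pow-1 (suc k) = trans (*-identityˡ _) (pow-1 k)

  pow-* : ∀ x a b → pow x (a * b) ≡ pow (pow x a) b
  pow-* x zero    b = sym (pow-1 b)
  pow-* x (suc a) b = begin
    pow x (b + a * b)              ≡⟨ pow-+ x b (a * b) ⟩
    pow x b ⊗ pow x (a * b)        ≡⟨ cong (pow x b ⊗_) (pow-* x a b) ⟩
    pow x b ⊗ pow (pow x a) b      ≡⟨ pow-⊗ x (pow x a) b ⟨
    pow (x ⊗ pow x a) b            ∎

  pow≡0⇒≡0 : ∀ x k → pow x k ≡ 0# → x ≡ 0#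
  pow≡0⇒≡0 x zero    eq = contradiction (sym eq) 0≢1
  pow≡0⇒≡0 x (suc k) eq with integral eq
  ... | inj₁ p = p
  ... | inj₂ p = pow≡0⇒≡0 x k p

  ∈-elems : ∀ x → x ∈ elems
  ∈-elems x = subst (_∈ elems) (Inverse.strictlyInverseˡ enum x)
    (∈-map⁺ (Inverse.to enum) (∈-allFin (Inverse.from enum x)))

  elems-unique : Unique elems
  elems-unique = Uniqueₚ.map⁺ to-injective (Uniqueₚ.allFin⁺ (q ^ n))
    where
    to-injective : ∀ {i j} → Inverse.to enum i ≡ Inverse.to enum j → i ≡ j
    to-injective {i} {j} eq = trans (sym (Inverse.strictlyInverseʳ enum i))
      (trans (cong (Inverse.from enum) eq) (Inverse.strictlyInverseʳ enum j))

  length-elems : length elems ≡ q ^ n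
  length-elems = trans (length-map _ (allFin (q ^ n))) (length-tabulate {n = q ^ n} (λ i → i))

  private
    -- Serves to compare a sum or product over `xs` with the one over its image under a translation
    -- or a scaling.
    permuted : ∀ {xs : List Carrier} (f g : Carrier → Carrier) → Unique xs →
      (∀ x → g (f x) ≡ x) → (∀ x → f (g x) ≡ x) →
      (∀ {x} → x ∈ xs → f x ∈ xs) → (∀ {x} → x ∈ xs → g x ∈ xs) → map f xs ↭ xs
    permuted {xs} f g u gf fg f∈ g∈ = ∼bag⇒↭ (unique∧set⇒bag
      (Uniqueₚ.map⁺ (λ {x} {y} eq → trans (sym (gf x)) (trans (cong g eq) (gf y))) u) u
      (mk⇔ (λ y∈ → to y∈) (λ y∈ → subst (_∈ map f xs) (fg _) (∈-map⁺ f (g∈ y∈)))))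
      where
      to : ∀ {y} → y ∈ map f xs → y ∈ xs
      to y∈ with ∈-map⁻ f y∈
      ... | x , x∈ , refl = f∈ x∈

  ∑ ∏ : List Carrier → Carrier
  ∑ = foldr _⊕_ 0#
  ∏ = foldr _⊗_ 1#

  -- Translation by 1 permutes the field, so the sum S of all elements satisfies S = S + q^n · 1.
  card·1≡0 : (q ^ n) · 1# ≡ 0#
  card·1≡0 = identityʳ-unique (∑ elems) ((q ^ n) · 1#) (begin
    ∑ elems ⊕ (q ^ n) · 1#       ≡⟨ cong (λ k → ∑ elems ⊕ k · 1#) length-elems ⟨
    ∑ elems ⊕ length elems · 1#  ≡⟨ ∑-shift elems ⟨
    ∑ (map (1# ⊕_) elems)        ≡⟨ foldr-commMonoid (setoid Carrier) (CommutativeRing.+-isCommutativeMonoid commutativeRing) (↭⇒↭ₛ shifted) ⟩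
    ∑ elems                      ∎)
    where
    ∑-shift : ∀ xs → ∑ (map (1# ⊕_) xs) ≡ ∑ xs ⊕ length xs · 1#
    ∑-shift [] = sym (+-identityˡ 0#)
    ∑-shift (x ∷ xs) = trans (cong ((1# ⊕ x) ⊕_) (∑-shift xs))
      (solve 4 (λ a b c d → (a :+ b) :+ (c :+ d) := (b :+ c) :+ (a :+ d)) refl 1# x (∑ xs) (length xs · 1#))
    shifted : map (1# ⊕_) elems ↭ elems
    shifted = permuted (1# ⊕_) (⊖ 1# ⊕_) elems-unique
      (λ x → solve 2 (λ a x → :- a :+ (a :+ x) := x) refl 1# x)
      (λ x → solve 2 (λ a x → a :+ (:- a :+ x) := x) refl 1# x)
      (λ _ → ∈-elems _) (λ _ → ∈-elems _)

  nonzero : List Carrier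
  nonzero = filter (λ x → ¬? (x ≟ 0#)) elems

  ∈-nonzero : ∀ {x} → x ≢ 0# → x ∈ nonzero
  ∈-nonzero {x} = ∈-filter⁺ (λ x → ¬? (x ≟ 0#)) (∈-elems x)

  nonzero-≢0 : ∀ {x} → x ∈ nonzero → x ≢ 0#
  nonzero-≢0 x∈ = proj₂ (∈-filter⁻ (λ x → ¬? (x ≟ 0#)) {xs = elems} x∈)

  nonzero-unique : Unique nonzero
  nonzero-unique = Uniqueₚ.filter⁺ (λ x → ¬? (x ≟ 0#)) elems-unique

  length-nonzero : suc (length nonzero) ≡ q ^ n
  length-nonzero = trans (unique-≋⇒length-≡ {xs = 0# ∷ nonzero}
      (All.tabulate (λ x∈ 0≡x → nonzero-≢0 x∈ (sym 0≡x)) ∷ nonzero-unique)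
      elems-unique (λ _ → ∈-elems _) (λ {x} _ → covers x)) length-elems
    where
    covers : ∀ x → x ∈ 0# ∷ nonzero
    covers x with x ≟ 0#
    ... | yes x≡0 = here x≡0
    ... | no x≢0  = there (∈-nonzero x≢0)

  -- Multiplication by a permutes the nonzero elements, so their nonzero product P satisfies P = a^N
  -- P, with N their number.
  pow-nonzero : ∀ {a} → a ≢ 0# → pow a (length nonzero) ≡ 1#
  pow-nonzero {a} a≢0 = ⊗-cancelˡ (∏-≢0 nonzero nonzero-≢0) (begin
    ∏ nonzero ⊗ pow a (length nonzero) ≡⟨ *-comm _ _ ⟩
    pow a (length nonzero) ⊗ ∏ nonzero ≡⟨ ∏-scale nonzero ⟨
    ∏ (map (a ⊗_) nonzero)             ≡⟨ foldr-commMonoid (setoid Carrier) (CommutativeRing.*-isCommutativeMonoid commutativeRing) (↭⇒↭ₛ scaled) ⟩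
    ∏ nonzero                          ≡⟨ *-identityʳ _ ⟨
    ∏ nonzero ⊗ 1#                     ∎)
    where
    ∏-scale : ∀ xs → ∏ (map (a ⊗_) xs) ≡ pow a (length xs) ⊗ ∏ xs
    ∏-scale [] = sym (*-identityˡ 1#)
    ∏-scale (x ∷ xs) = trans (cong ((a ⊗ x) ⊗_) (∏-scale xs))
      (solve 4 (λ a x b c → (a :* x) :* (b :* c) := (a :* b) :* (x :* c)) refl a x (pow a (length xs)) (∏ xs))
    ∏-≢0 : ∀ xs → (∀ {x} → x ∈ xs → x ≢ 0#) → ∏ xs ≢ 0#
    ∏-≢0 []       _ = 0≢1 ∘ sym
    ∏-≢0 (x ∷ xs) h = ⊗-≢0 (h (here refl)) (∏-≢0 xs (h ∘ there))
    a⁻¹ = inv a≢0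
    scaled : map (a ⊗_) nonzero ↭ nonzero
    scaled = permuted (a ⊗_) (a⁻¹ ⊗_) nonzero-unique
      (λ x → trans (sym (*-assoc _ _ _)) (trans (cong (_⊗ x) (inv-inverseˡ a≢0)) (*-identityˡ x)))
      (λ x → trans (sym (*-assoc _ _ _)) (trans (cong (_⊗ x) (inv-inverseʳ a≢0)) (*-identityˡ x)))
      (λ x∈ → ∈-nonzero (⊗-≢0 a≢0 (nonzero-≢0 x∈)))
      (λ x∈ → ∈-nonzero (⊗-≢0 (inv-≢0 a≢0) (nonzero-≢0 x∈)))

  frob-n : ∀ x → frob n x ≡ x
  -- Writing q^n as the successor of the number of nonzero elements unfolds the power to x times the
  -- power in `pow-nonzero`.
  frob-n x = subst (λ k → pow x k ≡ x) length-nonzero (go (x ≟ 0#))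
    where
    go : _ → x ⊗ pow x (length nonzero) ≡ x
    go (yes refl) = zeroˡ _
    go (no x≢0)   = trans (cong (x ⊗_) (pow-nonzero x≢0)) (*-identityʳ x)

  module _ {p e : ℕ} (pp : Prime p) (q≡p^e : q ≡ p ^ e) where

    -- A power of p · 1 is q^n · 1 = 0, and a field has no nilpotent elements.
    p·1≡0 : p · 1# ≡ 0#
    p·1≡0 = pow≡0⇒≡0 (p · 1#) (e * n) (begin
      pow (p · 1#) (e * n) ≡⟨ ·1-pow (e * n) ⟨
      (p ^ (e * n)) · 1#   ≡⟨ cong (_· 1#) (ℕₚ.^-*-assoc p e n) ⟨
      ((p ^ e) ^ n) · 1#   ≡⟨ cong (λ t → (t ^ n) · 1#) q≡p^e ⟨
      (q ^ n) · 1#         ≡⟨ card·1≡0 ⟩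
      0#                   ∎)
      where
      ·1-pow : ∀ k → (p ^ k) · 1# ≡ pow (p · 1#) k
      ·1-pow zero    = +-identityʳ 1#
      ·1-pow (suc k) = trans (×1-homo-* p (p ^ k)) (cong ((p · 1#) ⊗_) (·1-pow k))

    p∣m⇒m·x≡0 : ∀ {m} x → p ∣ m → m · x ≡ 0#
    p∣m⇒m·x≡0 x (divides c refl) = begin
      (c * p) · x        ≡⟨ cong (_· x) (ℕₚ.*-comm c p) ⟩
      (p * c) · x        ≡⟨ ×-assocˡ x p c ⟨
      p · (c · x)        ≡⟨ cong (p ·_) (*-identityˡ (c · x)) ⟨
      p · (1# ⊗ (c · x)) ≡⟨ ×-assoc-* p 1# (c · x) ⟨
      (p · 1#) ⊗ (c · x) ≡⟨ cong (_⊗ (c · x)) p·1≡0 ⟩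
      0# ⊗ (c · x)       ≡⟨ zeroˡ _ ⟩
      0#                 ∎

    pow-p-⊕ : ∀ x y → pow (x ⊕ y) p ≡ pow x p ⊕ pow y p
    pow-p-⊕ x y = expansion p (ℕₚ.<-trans (s≤s z≤n) (nonTrivial⇒n>1 p {{prime⇒nonTrivial pp}}))
        (λ k 0<k k<p z → p∣m⇒m·x≡0 z (prime∣C pp k 0<k k<p))
      where
      open import Algebra.Properties.CommutativeSemiring.Binomial commutativeSemiring using (theorem; binomialTerm)
      open import Algebra.Properties.Semiring.Sum semiring using (sum; sum-init-last; sum-cong-≗; sum-replicate-zero)
      open import Algebra.Properties.Semiring.Exp semiring renaming (_^_ to _^ᴷ_) using ()
      open import Data.Vec.Functional using (tail; init; last)
      pow≡^ : ∀ z k → pow z k ≡ z ^ᴷ k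
      pow≡^ z zero    = refl
      pow≡^ z (suc k) = cong (z ⊗_) (pow≡^ z k)
      -- The exponent is a fresh variable, so that it can be matched as a successor to expose both
      -- end terms of the binomial sum; what primality gives is handed over as `vanish`.
      expansion : ∀ m → 0 < m → (∀ k → 0 < k → k < m → ∀ z → (m C k) · z ≡ 0#) →
        pow (x ⊕ y) m ≡ pow x m ⊕ pow y m
      expansion m@(suc m-1) _ vanish = begin
        pow (x ⊕ y) m                         ≡⟨ pow≡^ (x ⊕ y) m ⟩
        (x ⊕ y) ^ᴷ m                          ≡⟨ theorem m x y ⟩
        t Fin.zero ⊕ sum (tail t)             ≡⟨ cong (t Fin.zero ⊕_) (sum-init-last (tail t)) ⟩
        t Fin.zero ⊕ (sum (init (tail t)) ⊕ last (tail t))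
                                              ≡⟨ cong₂ _⊕_ first (cong₂ _⊕_ middle end) ⟩
        pow y m ⊕ (0# ⊕ pow x m)              ≡⟨ cong (pow y m ⊕_) (+-identityˡ _) ⟩
        pow y m ⊕ pow x m                     ≡⟨ +-comm _ _ ⟩
        pow x m ⊕ pow y m                     ∎
        where
        t = binomialTerm x y m
        first : t Fin.zero ≡ pow y m
        first = trans (+-identityʳ _) (trans (*-identityˡ _) (sym (pow≡^ y m)))
        middle : sum (init (tail t)) ≡ 0#
        middle = trans (sum-cong-≗ zeros) (sum-replicate-zero m-1)
          where
          zeros : ∀ i → init (tail t) i ≡ 0#
          zeros i = vanish (suc (Fin.toℕ (Fin.inject₁ i))) (s≤s z≤n)
            (s≤s (subst (_< m-1) (sym (Finₚ.toℕ-inject₁ i)) (Finₚ.toℕ<n i))) _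
        end : last (tail t) ≡ pow x m
        end rewrite Finₚ.toℕ-fromℕ m-1 | nCn≡1 m | ℕₚ.n∸n≡0 m-1 =
          trans (+-identityʳ _) (trans (*-identityʳ _) (sym (pow≡^ x m)))

    pow-p^k-⊕ : ∀ k x y → pow (x ⊕ y) (p ^ k) ≡ pow x (p ^ k) ⊕ pow y (p ^ k)
    pow-p^k-⊕ zero    x y = distribʳ 1# x y
    pow-p^k-⊕ (suc k) x y = begin
      pow (x ⊕ y) (p * p ^ k)                       ≡⟨ pow-* (x ⊕ y) p (p ^ k) ⟩
      pow (pow (x ⊕ y) p) (p ^ k)                   ≡⟨ cong (λ z → pow z (p ^ k)) (pow-p-⊕ x y) ⟩
      pow (pow x p ⊕ pow y p) (p ^ k)               ≡⟨ pow-p^k-⊕ k (pow x p) (pow y p) ⟩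
      pow (pow x p) (p ^ k) ⊕ pow (pow y p) (p ^ k) ≡⟨ cong₂ _⊕_ (pow-* x p (p ^ k)) (pow-* y p (p ^ k)) ⟨
      pow x (p * p ^ k) ⊕ pow y (p * p ^ k)         ∎

    frob-⊕ : ∀ k x y → frob k (x ⊕ y) ≡ frob k x ⊕ frob k y
    frob-⊕ k x y = subst (λ m → pow (x ⊕ y) m ≡ pow x m ⊕ pow y m)
      (trans (sym (ℕₚ.^-*-assoc p e k)) (cong (_^ k) (sym q≡p^e))) (pow-p^k-⊕ (e * k) x y)

-- Roots of polynomials and the size of F_q

length-filter-complement : ∀ {a p} {A : Set a} {P : A → Set p} (P? : Decidable P) (xs : List A) →
  length (filter P? xs) + length (filter (¬? ∘ P?) xs) ≡ length xs
length-filter-complement P? [] = refl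
length-filter-complement P? (x ∷ xs) with P? x
... | yes _ = cong suc (length-filter-complement P? xs)
... | no _  = trans (ℕₚ.+-suc _ _) (cong suc (length-filter-complement P? xs))

-- Used as the divisibility of q^n - 1 by q - 1. The quotient is a successor because N counts the
-- nonconstant terms of the cofactor `geometric`.
geometric-sum : ∀ m n → ∃[ N ] (suc m ^ suc n ≡ suc (m * suc N))
geometric-sum m zero    = 0 , cong suc (trans (ℕₚ.*-identityʳ m) (sym (ℕₚ.*-identityʳ m)))
geometric-sum m (suc n) =
  let N , eq = geometric-sum m n
  in suc m * suc N , trans (cong (suc m *_) eq) (step m N)
  where
  step : ∀ m N → suc m * suc (m * suc N) ≡ suc (m * suc (suc m * suc N))
  step = solve-∀

module ScalarField {q n : ℕ} (K : FiniteField q n) where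

  open FieldTheory K
  open ≡-Reasoning

  -- The coefficients below the leading one of a monic polynomial, constant term first.
  eval : List Carrier → Carrier → Carrier
  eval []       x = 1#
  eval (a ∷ as) x = a ⊕ x ⊗ eval as x

  -- Synthetic division by X - r: the coefficients of the quotient are the Horner values at r of the
  -- successive tails.
  deflate : Carrier → Carrier → List Carrier → List Carrier
  deflate r a []        = []
  deflate r a (b ∷ bs)  = eval (b ∷ bs) r ∷ deflate r b bs

  length-deflate : ∀ r a as → length (deflate r a as) ≡ length as
  length-deflate r a []       = refl
  length-deflate r a (b ∷ bs) = cong suc (length-deflate r b bs)

  eval-deflate : ∀ r a as x →
    eval (a ∷ as) x ⊝ eval (a ∷ as) r ≡ (x ⊝ r) ⊗ eval (deflate r a as) x
  eval-deflate r a []       x = solve 4 (λ a x r o → (a :+ x :* o) :- (a :+ r :* o) := (x :- r) :* o) refl a x r 1#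
  eval-deflate r a (b ∷ bs) x = begin
    (a ⊕ x ⊗ v) ⊝ (a ⊕ r ⊗ w)    ≡⟨ solve 5 (λ a x r v w → (a :+ x :* v) :- (a :+ r :* w) := x :* (v :- w) :+ (x :- r) :* w) refl a x r v w ⟩
    x ⊗ (v ⊝ w) ⊕ (x ⊝ r) ⊗ w    ≡⟨ cong (λ t → x ⊗ t ⊕ (x ⊝ r) ⊗ w) (eval-deflate r b bs x) ⟩
    x ⊗ ((x ⊝ r) ⊗ d) ⊕ (x ⊝ r) ⊗ w  ≡⟨ solve 4 (λ x r d w → x :* ((x :- r) :* d) :+ (x :- r) :* w := (x :- r) :* (w :+ x :* d)) refl x r d w ⟩
    (x ⊝ r) ⊗ (w ⊕ x ⊗ d)        ∎
    where
    v = eval (b ∷ bs) x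
    w = eval (b ∷ bs) r
    d = eval (deflate r b bs) x

  -- Dividing by X - r lowers the degree by one, and any other root is a root of the quotient
  -- because the field has no zero divisors.
  length-roots : ∀ as {xs} → Unique xs → (∀ {x} → x ∈ xs → eval as x ≡ 0#) → length xs ≤ length as
  length-roots as []      roots = z≤n
  length-roots [] (_ ∷ _) roots = contradiction (sym (roots (here refl))) 0≢1
  length-roots (a ∷ as) {r ∷ xs} (r∉ ∷ u) roots =
    s≤s (subst (length xs ≤_) (length-deflate r a as) (length-roots (deflate r a as) u deflated))
    where
    deflated : ∀ {x} → x ∈ xs → eval (deflate r a as) x ≡ 0#
    deflated {x} x∈ with integral (trans (sym (eval-deflate r a as x))
      (trans (cong₂ _⊝_ (roots (there x∈)) (roots (here refl))) (-‿inverseʳ 0#)))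
    ... | inj₁ x⊝r≡0 = contradiction (sym (x⊝y≡0⇒x≡y x⊝r≡0)) (All.lookup r∉ x∈)
    ... | inj₂ p     = p

  eval-shift : ∀ k as x → eval (replicate k 0# ++ as) x ≡ pow x k ⊗ eval as x
  eval-shift zero    as x = sym (*-identityˡ _)
  eval-shift (suc k) as x = begin
    0# ⊕ x ⊗ eval (replicate k 0# ++ as) x  ≡⟨ +-identityˡ _ ⟩
    x ⊗ eval (replicate k 0# ++ as) x       ≡⟨ cong (x ⊗_) (eval-shift k as x) ⟩
    x ⊗ (pow x k ⊗ eval as x)               ≡⟨ *-assoc _ _ _ ⟨
    pow x (suc k) ⊗ eval as x               ∎

  -- 1 + X^(k+1) + … + X^((k+1) N)
  geometric : ℕ → ℕ → List Carrier
  geometric k zero    = []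
  geometric k (suc N) = 1# ∷ replicate k 0# ++ geometric k N

  length-geometric : ∀ k N → length (geometric k N) ≡ suc k * N
  length-geometric k zero    = sym (ℕₚ.*-zeroʳ (suc k))
  length-geometric k (suc N) = trans
    (cong suc (trans (length-++ (replicate k 0#)) (cong₂ _+_ (length-replicate k) (length-geometric k N))))
    (sym (ℕₚ.*-suc (suc k) N))

  eval-geometric : ∀ k N x → (pow x (suc k) ⊝ 1#) ⊗ eval (geometric k N) x ≡ pow (pow x (suc k)) (suc N) ⊝ 1#
  eval-geometric k zero    x = trans (*-identityʳ _) (cong (_⊝ 1#) (sym (*-identityʳ _)))
  eval-geometric k (suc N) x = begin
    (y ⊝ 1#) ⊗ (1# ⊕ x ⊗ eval (replicate k 0# ++ geometric k N) x)
      ≡⟨ cong (λ t → (y ⊝ 1#) ⊗ (1# ⊕ x ⊗ t)) (eval-shift k (geometric k N) x) ⟩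
    (y ⊝ 1#) ⊗ (1# ⊕ x ⊗ (pow x k ⊗ g))
      ≡⟨ cong (λ t → (y ⊝ 1#) ⊗ (1# ⊕ t)) (sym (*-assoc x (pow x k) g)) ⟩
    (y ⊝ 1#) ⊗ (1# ⊕ y ⊗ g)
      ≡⟨ solve 3 (λ o y g → (y :- o) :* (o :+ y :* g) := (y :- o) :* o :+ y :* ((y :- o) :* g)) refl 1# y g ⟩
    (y ⊝ 1#) ⊗ 1# ⊕ y ⊗ ((y ⊝ 1#) ⊗ g)
      ≡⟨ cong₂ (λ s t → s ⊕ y ⊗ t) (*-identityʳ _) (eval-geometric k N x) ⟩
    (y ⊝ 1#) ⊕ y ⊗ (pow y (suc N) ⊝ 1#)
      ≡⟨ cong ((y ⊝ 1#) ⊕_) (trans (distribˡ y _ _) (cong (y ⊗ pow y (suc N) ⊕_) y⊗⊖1)) ⟩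
    (y ⊝ 1#) ⊕ (pow y (suc (suc N)) ⊝ y)
      ≡⟨ solve 3 (λ y o z → (y :- o) :+ (z :- y) := z :- o) refl y 1# (pow y (suc (suc N))) ⟩
    pow y (suc (suc N)) ⊝ 1# ∎
    where
    y = pow x (suc k)
    g = eval (geometric k N) x
    y⊗⊖1 : y ⊗ ⊖ 1# ≡ ⊖ y
    y⊗⊖1 = trans (solve 2 (λ y o → y :* :- o := :- (y :* o)) refl y 1#) (cong ⊖_ (*-identityʳ y))

  Fq : List Carrier
  Fq = filter (λ x → pow x q ≟ x) elems

  ∈-Fq : ∀ {x} → InFq x → x ∈ Fq
  ∈-Fq {x} = ∈-filter⁺ (λ x → pow x q ≟ x) (∈-elems x)

  Fq⇒InFq : ∀ {x} → x ∈ Fq → InFq x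
  Fq⇒InFq x∈ = proj₂ (∈-filter⁻ (λ x → pow x q ≟ x) {xs = elems} x∈)

  Fq-unique : Unique Fq
  Fq-unique = Uniqueₚ.filter⁺ (λ x → pow x q ≟ x) elems-unique

  -- The q^n − 1 nonzero elements are roots of (X^(q-1) − 1)(1 + X^(q-1) + … ), and neither
  -- factor has more roots than its degree.
  length-Fq : ∀ {k m} → q ≡ suc (suc k) → n ≡ suc m → length Fq ≡ q
  length-Fq {k} {m} refl refl with geometric-sum (suc k) m
  ... | N , card≡ = begin
    length Fq                ≡⟨ unique-≋⇒length-≡ Fq-unique 0∷units-unique to from ⟩
    suc (length units)       ≡⟨ cong suc length-units ⟩
    suc (suc k)              ∎
    where
    unit? : Decidable (λ x → pow x (suc k) ≡ 1#)
    unit? x = pow x (suc k) ≟ 1#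
    units = filter unit? nonzero
    others = filter (¬? ∘ unit?) nonzero

    units≤ : length units ≤ suc k
    units≤ = subst (length units ≤_) (cong suc (trans (length-++ (replicate k 0#)) (trans (ℕₚ.+-identityʳ _) (length-replicate k))))
      (length-roots (⊖ 1# ∷ replicate k 0# ++ []) (Uniqueₚ.filter⁺ unit? nonzero-unique)
        λ {x} x∈ → trans
          (cong (λ t → ⊖ 1# ⊕ x ⊗ t) (trans (eval-shift k [] x) (*-identityʳ _)))
          (trans (+-comm _ _) (x≡y⇒x⊝y≡0 (proj₂ (∈-filter⁻ unit? {xs = nonzero} x∈)))))

    total : length nonzero ≡ suc k * suc N
    total = ℕₚ.suc-injective (trans length-nonzero card≡)

    others≤ : length others ≤ suc k * N
    others≤ = subst (length others ≤_) (length-geometric k N)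
      (length-roots (geometric k N) (Uniqueₚ.filter⁺ (¬? ∘ unit?) nonzero-unique) root)
      where
      root : ∀ {x} → x ∈ others → eval (geometric k N) x ≡ 0#
      root {x} x∈ with ∈-filter⁻ (¬? ∘ unit?) {xs = nonzero} x∈
      ... | x∈nz , ¬unit with integral (trans (eval-geometric k N x) (x≡y⇒x⊝y≡0
              (trans (sym (pow-* x (suc k) (suc N))) (trans (cong (pow x) (sym total)) (pow-nonzero (nonzero-≢0 x∈nz))))))
      ...   | inj₁ eq = contradiction (x⊝y≡0⇒x≡y eq) ¬unit
      ...   | inj₂ eq = eq

    -- The bounds q - 1 and (q - 1)N add up to exactly the q^n - 1 nonzero elements, so neither of
    -- them is strict.
    length-units : length units ≡ suc k
    length-units = ℕₚ.≤-antisym units≤ (ℕₚ.+-cancelʳ-≤ (suc k * N) (suc k) (length units) (ℕₚ.≤-trans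
      (ℕₚ.≤-reflexive (trans (sym (ℕₚ.*-suc (suc k) N)) (trans (sym total) (sym (length-filter-complement unit? nonzero)))))
      (ℕₚ.+-monoʳ-≤ (length units) others≤)))

    0∷units-unique : Unique (0# ∷ units)
    0∷units-unique = All.tabulate (λ x∈ 0≡x → nonzero-≢0 (proj₁ (∈-filter⁻ unit? {xs = nonzero} x∈)) (sym 0≡x))
      ∷ Uniqueₚ.filter⁺ unit? nonzero-unique

    to : ∀ {x} → x ∈ Fq → x ∈ 0# ∷ units
    to {x} x∈ with x ≟ 0#
    ... | yes x≡0 = here x≡0
    ... | no x≢0  = there (∈-filter⁺ unit? (∈-nonzero x≢0) (⊗-cancelˡ x≢0 (trans (Fq⇒InFq x∈) (sym (*-identityʳ x)))))

    from : ∀ {x} → x ∈ 0# ∷ units → x ∈ Fq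
    from (here refl) = ∈-Fq (zeroˡ _)
    from {x} (there x∈) = ∈-Fq (trans (cong (x ⊗_) (proj₂ (∈-filter⁻ unit? {xs = nonzero} x∈))) (*-identityʳ x))

-- Linear algebra over the fixed field of σ

module Automorphism {q n : ℕ} (K : FiniteField q n) where

  open FieldTheory K

  -- Stated for one map with a right inverse, in order to be instantiated at both (`σ`, `τ`) and
  -- (`τ`, `σ`).
  module Laws (φ ψ : Carrier → Carrier)
    (φ-⊕ : ∀ x y → φ (x ⊕ y) ≡ φ x ⊕ φ y) (φ-⊗ : ∀ x y → φ (x ⊗ y) ≡ φ x ⊗ φ y)
    (φψ : ∀ x → φ (ψ x) ≡ x) where

    auto-0 : φ 0# ≡ 0#
    auto-0 = trans (solve 2 (λ x y → y := (x :+ y) :- x) refl (φ 0#) (φ 0#))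
      (x≡y⇒x⊝y≡0 (trans (sym (φ-⊕ 0# 0#)) (cong φ (+-identityˡ 0#))))

    -- Multiplicativity alone would allow φ 1 = 0; multiplying by φ (ψ 1) = 1 excludes this.
    auto-1 : φ 1# ≡ 1#
    auto-1 = trans (sym (*-identityʳ _)) (trans (cong (φ 1# ⊗_) (sym (φψ 1#)))
      (trans (sym (φ-⊗ 1# (ψ 1#))) (trans (cong φ (*-identityˡ _)) (φψ 1#))))

    auto-⊖ : ∀ x → φ (⊖ x) ≡ ⊖ φ x
    auto-⊖ x = trans (solve 2 (λ a b → b := (a :+ b) :- a) refl (φ x) (φ (⊖ x)))
      (trans (cong (_⊝ φ x) (trans (sym (φ-⊕ x (⊖ x))) (trans (cong φ (-‿inverseʳ x)) auto-0)))
        (+-identityˡ _))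

    auto-⊝ : ∀ x y → φ (x ⊝ y) ≡ φ x ⊝ φ y
    auto-⊝ x y = trans (φ-⊕ x (⊖ y)) (cong (φ x ⊕_) (auto-⊖ y))

-- Everything that the counting uses of x ↦ x^(q^s), free of exponents. Coprimality of s and n is
-- contained in `fixed⇒InFq`.
record GaloisGenerator {q n : ℕ} (K : FiniteField q n) : Set where
  open FieldTheory K
  open ScalarField K
  field
    σ τ        : Carrier → Carrier
    σ-⊕        : ∀ x y → σ (x ⊕ y) ≡ σ x ⊕ σ y
    σ-⊗        : ∀ x y → σ (x ⊗ y) ≡ σ x ⊗ σ y
    στ         : ∀ x → σ (τ x) ≡ x
    τσ         : ∀ x → τ (σ x) ≡ x
    InFq⇒fixed : ∀ {x} → InFq x → σ x ≡ x
    fixed⇒InFq : ∀ {x} → σ x ≡ x → InFq x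
    ∣Fq∣≡q     : length Fq ≡ q
    1<q        : 1 < q

module SpanTheory {q n : ℕ} (K : FiniteField q n) (generator : GaloisGenerator K) where

  open FieldTheory K
  open ScalarField K
  open GaloisGenerator generator public
  open ≡-Reasoning
  open Automorphism.Laws K σ τ σ-⊕ σ-⊗ στ public
    renaming (auto-0 to σ-0; auto-1 to σ-1; auto-⊖ to σ-⊖; auto-⊝ to σ-⊝)

  τ-⊕ : ∀ x y → τ (x ⊕ y) ≡ τ x ⊕ τ y
  τ-⊕ x y = trans (cong₂ (λ a b → τ (a ⊕ b)) (sym (στ x)) (sym (στ y)))
    (trans (cong τ (sym (σ-⊕ (τ x) (τ y)))) (τσ _))

  τ-⊗ : ∀ x y → τ (x ⊗ y) ≡ τ x ⊗ τ y
  τ-⊗ x y = trans (cong₂ (λ a b → τ (a ⊗ b)) (sym (στ x)) (sym (στ y)))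
    (trans (cong τ (sym (σ-⊗ (τ x) (τ y)))) (τσ _))

  open Automorphism.Laws K τ σ τ-⊕ τ-⊗ τσ public
    renaming (auto-0 to τ-0; auto-1 to τ-1; auto-⊖ to τ-⊖; auto-⊝ to τ-⊝)

  σ-injective : ∀ {x y} → σ x ≡ σ y → x ≡ y
  σ-injective {x} {y} eq = trans (sym (τσ x)) (trans (cong τ eq) (τσ y))

  σ-≢0 : ∀ {x} → x ≢ 0# → σ x ≢ 0#
  σ-≢0 x≢0 eq = x≢0 (σ-injective (trans eq (sym σ-0)))

  Fixed : Carrier → Set
  Fixed c = σ c ≡ c

  fixed-τ : ∀ {c} → Fixed c → τ c ≡ c
  fixed-τ {c} fc = trans (cong τ (sym fc)) (τσ c)

  fixed-⊕ : ∀ {c d} → Fixed c → Fixed d → Fixed (c ⊕ d)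
  fixed-⊕ fc fd = trans (σ-⊕ _ _) (cong₂ _⊕_ fc fd)

  fixed-⊗ : ∀ {c d} → Fixed c → Fixed d → Fixed (c ⊗ d)
  fixed-⊗ fc fd = trans (σ-⊗ _ _) (cong₂ _⊗_ fc fd)

  fixed-⊖ : ∀ {c} → Fixed c → Fixed (⊖ c)
  fixed-⊖ fc = trans (σ-⊖ _) (cong ⊖_ fc)

  fixed-⊝ : ∀ {c d} → Fixed c → Fixed d → Fixed (c ⊝ d)
  fixed-⊝ fc fd = fixed-⊕ fc (fixed-⊖ fd)

  fixed-inv : ∀ {c} (c≢0 : c ≢ 0#) → Fixed c → Fixed (inv c≢0)
  fixed-inv {c} c≢0 fc = ⊗-cancelˡ c≢0 (begin
    c ⊗ σ (inv c≢0)     ≡⟨ cong (_⊗ σ (inv c≢0)) fc ⟨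
    σ c ⊗ σ (inv c≢0)   ≡⟨ σ-⊗ c (inv c≢0) ⟨
    σ (c ⊗ inv c≢0)     ≡⟨ cong σ (inv-inverseʳ c≢0) ⟩
    σ 1#                ≡⟨ σ-1 ⟩
    1#                  ≡⟨ inv-inverseʳ c≢0 ⟨
    c ⊗ inv c≢0         ∎)

  -- The hypothesis is σ (y / x) = y / x with denominators cleared.
  fixed-ratio : ∀ {x y} → x ≢ 0# → x ⊗ σ y ≡ σ x ⊗ y → ∃[ c ] (Fixed c × y ≡ c ⊗ x)
  fixed-ratio {x} {y} x≢0 eq = c , c-fixed , sym cx≡y
    where
    c = y ⊗ inv x≢0
    cx≡y : c ⊗ x ≡ y
    cx≡y = trans (*-assoc _ _ _) (trans (cong (y ⊗_) (inv-inverseˡ x≢0)) (*-identityʳ y))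
    c-fixed : Fixed c
    c-fixed = ⊗-cancelˡ (⊗-≢0 x≢0 (σ-≢0 x≢0)) (begin
      (x ⊗ σ x) ⊗ σ c     ≡⟨ solve 3 (λ a b d → (a :* b) :* d := a :* (d :* b)) refl x (σ x) (σ c) ⟩
      x ⊗ (σ c ⊗ σ x)     ≡⟨ cong (x ⊗_) (trans (sym (σ-⊗ c x)) (cong σ cx≡y)) ⟩
      x ⊗ σ y             ≡⟨ eq ⟩
      σ x ⊗ y             ≡⟨ cong (σ x ⊗_) (sym cx≡y) ⟩
      σ x ⊗ (c ⊗ x)       ≡⟨ solve 3 (λ a b d → b :* (d :* a) := (a :* b) :* d) refl x (σ x) c ⟩
      (x ⊗ σ x) ⊗ c       ∎)

  span : List Carrier → List Carrier
  span []       = 0# ∷ []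
  span (x ∷ xs) = map (λ { (c , v) → c ⊗ x ⊕ v }) (cartesianProduct Fq (span xs))

  -- The inductive counterpart of the list `span`: the list serves for counting, this family for
  -- arguing on combinations. Its scalars are the elements fixed by `σ`.
  data Span : List Carrier → Carrier → Set where
    []  : Span [] 0#
    _∷_ : ∀ {c x v xs} → Fixed c → Span xs v → Span (x ∷ xs) (c ⊗ x ⊕ v)

  Span⇒∈ : ∀ {xs v} → Span xs v → v ∈ span xs
  Span⇒∈ [] = here refl
  Span⇒∈ {x ∷ xs} (fc ∷ Sv) =
    ∈-map⁺ (λ { (c , v) → c ⊗ x ⊕ v }) (∈-cartesianProduct⁺ (∈-Fq (fixed⇒InFq fc)) (Span⇒∈ Sv))

  ∈⇒Span : ∀ xs {v} → v ∈ span xs → Span xs v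
  ∈⇒Span [] (here refl) = []
  ∈⇒Span (x ∷ xs) w∈ with ∈-map⁻ (λ { (c , v) → c ⊗ x ⊕ v }) w∈
  ... | (c , v) , cv∈ , refl with ∈-cartesianProduct⁻ Fq (span xs) cv∈
  ...   | c∈ , v∈ = InFq⇒fixed (Fq⇒InFq c∈) ∷ ∈⇒Span xs v∈

  span-0 : ∀ xs → Span xs 0#
  span-weaken : ∀ {x xs v} → Span xs v → Span (x ∷ xs) v

  span-0 []       = []
  span-0 (x ∷ xs) = span-weaken (span-0 xs)

  span-weaken {x} {xs} {v} Sv = subst (Span (x ∷ xs)) (trans (cong (_⊕ v) (zeroˡ x)) (+-identityˡ v))
    (σ-0 ∷ Sv)

  span-⊕ : ∀ {xs v w} → Span xs v → Span xs w → Span xs (v ⊕ w)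
  span-⊕ [] [] = subst (Span []) (sym (+-identityˡ 0#)) []
  span-⊕ {x ∷ xs} (_∷_ {c} {v = v} fc Sv) (_∷_ {d} {v = w} fd Sw) = subst (Span (x ∷ xs))
    (solve 5 (λ c d x v w → (c :+ d) :* x :+ (v :+ w) := (c :* x :+ v) :+ (d :* x :+ w)) refl c d x v w)
    (fixed-⊕ fc fd ∷ span-⊕ Sv Sw)

  span-scale : ∀ {xs d v} → Fixed d → Span xs v → Span xs (d ⊗ v)
  span-scale {d = d} fd [] = subst (Span []) (sym (zeroʳ d)) []
  span-scale {x ∷ xs} {d} fd (_∷_ {c} {v = v} fc Sv) = subst (Span (x ∷ xs))
    (solve 4 (λ c d x v → (d :* c) :* x :+ d :* v := d :* (c :* x :+ v)) refl c d x v)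
    (fixed-⊗ fd fc ∷ span-scale fd Sv)

  span-⊝ : ∀ {xs v w} → Span xs v → Span xs w → Span xs (v ⊝ w)
  span-⊝ {xs} {v} {w} Sv Sw = span-⊕ Sv (subst (Span xs)
    (trans (solve 2 (λ o w → (:- o) :* w := :- (o :* w)) refl 1# w) (cong ⊖_ (*-identityˡ w)))
    (span-scale (fixed-⊖ σ-1) Sw))

  span-head : ∀ {x xs} → Span (x ∷ xs) x
  span-head {x} {xs} = subst (Span (x ∷ xs)) (trans (+-identityʳ _) (*-identityˡ x)) (σ-1 ∷ span-0 xs)

  length-span : ∀ xs → length (span xs) ≡ q ^ length xs
  length-span []       = refl
  length-span (x ∷ xs) = trans (length-map _ (cartesianProduct Fq (span xs)))
    (trans (length-cartesianProduct Fq (span xs)) (cong₂ _*_ ∣Fq∣≡q (length-span xs)))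

  -- The triangular form of independence: a list grows by any element outside the span of what is
  -- already there.
  data Independent : List Carrier → Set where
    []  : Independent []
    _∷_ : ∀ {x xs} → ¬ Span xs x → Independent xs → Independent (x ∷ xs)

  span-solve : ∀ {x xs c w} → Fixed c → c ≢ 0# → Span xs w → c ⊗ x ≡ w → Span xs x
  span-solve {x} {xs} {c} fc c≢0 Sw eq = subst (Span xs)
    (⊗-cancelˡ c≢0 (begin
      c ⊗ (inv c≢0 ⊗ _)  ≡⟨ *-assoc _ _ _ ⟨
      (c ⊗ inv c≢0) ⊗ _  ≡⟨ cong₂ _⊗_ (inv-inverseʳ c≢0) (sym eq) ⟩
      1# ⊗ (c ⊗ x)       ≡⟨ *-identityˡ _ ⟩
      c ⊗ x              ∎))
    (span-scale (fixed-inv c≢0 fc) Sw)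

  -- If two equal combinations had different head coefficients, dividing by their difference would
  -- put the head into the span of the tail.
  span-unique : ∀ {xs} → Independent xs → Unique (span xs)
  span-unique [] = [] ∷ []
  span-unique {x ∷ xs} (x∉ ∷ ind) = unique-map coordinates
    (Uniqueₚ.cartesianProduct⁺ Fq-unique (span-unique ind))
    where
    coordinates : ∀ {a b} → a ∈ cartesianProduct Fq (span xs) → b ∈ cartesianProduct Fq (span xs) →
      proj₁ a ⊗ x ⊕ proj₂ a ≡ proj₁ b ⊗ x ⊕ proj₂ b → a ≡ b
    coordinates {c , v} {d , w} a∈ b∈ eq
      with ∈-cartesianProduct⁻ Fq (span xs) a∈ | ∈-cartesianProduct⁻ Fq (span xs) b∈ | c ≟ d
    ... | c∈ , v∈ | d∈ , w∈ | no c≢d = contradiction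
      (span-solve (fixed-⊝ (InFq⇒fixed (Fq⇒InFq c∈)) (InFq⇒fixed (Fq⇒InFq d∈))) (c≢d ∘ x⊝y≡0⇒x≡y)
        (span-⊝ (∈⇒Span xs w∈) (∈⇒Span xs v∈)) (begin
          (c ⊝ d) ⊗ x                   ≡⟨ solve 4 (λ c d x v → (c :- d) :* x := (c :* x :+ v) :- (d :* x :+ v)) refl c d x v ⟩
          (c ⊗ x ⊕ v) ⊝ (d ⊗ x ⊕ v)     ≡⟨ cong (_⊝ (d ⊗ x ⊕ v)) eq ⟩
          (d ⊗ x ⊕ w) ⊝ (d ⊗ x ⊕ v)     ≡⟨ solve 3 (λ a v w → (a :+ w) :- (a :+ v) := w :- v) refl (d ⊗ x) v w ⟩
          w ⊝ v                         ∎)) x∉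
    ... | c∈ , v∈ | d∈ , w∈ | yes refl = cong (c ,_) (begin
      v                       ≡⟨ solve 2 (λ a v → v := (a :+ v) :- a) refl (c ⊗ x) v ⟩
      (c ⊗ x ⊕ v) ⊝ c ⊗ x     ≡⟨ cong (_⊝ c ⊗ x) eq ⟩
      (c ⊗ x ⊕ w) ⊝ c ⊗ x     ≡⟨ solve 2 (λ a v → (a :+ v) :- a := v) refl (c ⊗ x) w ⟩
      w                       ∎)

  independent-head-≢0 : ∀ {x xs} → Independent (x ∷ xs) → x ≢ 0#
  independent-head-≢0 {xs = xs} (x∉ ∷ _) refl = x∉ (span-0 xs)

  module _ {u : ℕ} (W : Subspace K u) where

    open Subspace W

    private
      members : List Carrier
      members = filter (λ x → T? (⌊ U? x ⌋)) elems

      ∈-members : ∀ {x} → U x → x ∈ members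
      ∈-members {x} Ux = ∈-filter⁺ (λ x → T? (⌊ U? x ⌋)) (∈-elems x) (fromWitness Ux)

      members⇒U : ∀ {x} → x ∈ members → U x
      members⇒U x∈ = toWitness (proj₂ (∈-filter⁻ (λ x → T? (⌊ U? x ⌋)) {xs = elems} x∈))

      members-unique : Unique members
      members-unique = Uniqueₚ.filter⁺ (λ x → T? (⌊ U? x ⌋)) elems-unique

    span⊆U : ∀ {xs} → All U xs → ∀ {v} → Span xs v → U v
    span⊆U []         []        = zero∈
    span⊆U (Ux ∷ Uxs) (fc ∷ Sv) = +∈ (scal∈ (fixed⇒InFq fc) Ux) (span⊆U Uxs Sv)

    -- The span of k < u elements has at most q^k < q^u members, so U has an element outside it.
    independent-in : ∀ k → k ≤ u → ∃[ xs ] (length xs ≡ k × All U xs × Independent xs)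
    independent-in zero    _   = [] , refl , [] , []
    independent-in (suc k) k<u with independent-in k (ℕₚ.<⇒≤ k<u)
    ... | xs , refl , Uxs , ind
      with element-outside _≟_ {ys = span xs} members-unique
        (ℕₚ.≤-trans (ℕₚ.≤-reflexive (cong suc (length-span xs)))
          (ℕₚ.≤-trans (ℕₚ.^-monoʳ-< q 1<q k<u) (ℕₚ.≤-reflexive (sym card))))
    ...   | x , x∈ , x∉ = x ∷ xs , refl , members⇒U x∈ ∷ Uxs , (x∉ ∘ Span⇒∈) ∷ ind

    -- By cardinality: u independent elements of U have q^u distinct combinations, all in U, which
    -- has no more elements than that.
    basis-spans : ∀ {xs} → length xs ≡ u → All U xs → Independent xs → ∀ {v} → U v → Span xs v
    basis-spans {xs} refl Uxs ind Uv = ∈⇒Span xs (full-length⇒⊇ _≟_ (span-unique ind)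
      (∈-members ∘ span⊆U Uxs ∘ ∈⇒Span xs) (ℕₚ.≤-reflexive (trans card (sym (length-span xs)))) (∈-members Uv))

  -- Roots of σ-polynomials

  -- Σ aᵢ σⁱ, lowest coefficient first.
  evalσ : List Carrier → Carrier → Carrier
  evalσ []       x = 0#
  evalσ (a ∷ as) x = a ⊗ x ⊕ evalσ as (σ x)

  rescale : List Carrier → Carrier → List Carrier
  rescale []       x = []
  rescale (a ∷ as) x = a ⊗ x ∷ rescale as (σ x)

  evalσ-rescale : ∀ as x t → evalσ (rescale as x) t ≡ evalσ as (x ⊗ t)
  evalσ-rescale []       x t = refl
  evalσ-rescale (a ∷ as) x t = cong₂ _⊕_ (*-assoc a x t)
    (trans (evalσ-rescale as (σ x) (σ t)) (cong (evalσ as) (sym (σ-⊗ x t))))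

  length-rescale : ∀ as x → length (rescale as x) ≡ length as
  length-rescale []       x = refl
  length-rescale (a ∷ as) x = cong suc (length-rescale as (σ x))

  rescale-zero : ∀ as {x} → x ≢ 0# → All (_≡ 0#) (rescale as x) → All (_≡ 0#) as
  rescale-zero []       x≢0 []       = []
  rescale-zero (a ∷ as) {x} x≢0 (p ∷ ps) with integral p
  ... | inj₁ a≡0 = a≡0 ∷ rescale-zero as (σ-≢0 x≢0) ps
  ... | inj₂ x≡0 = contradiction x≡0 x≢0

  -- As σ 1 = 1, the coefficient sum is the value at 1; after rescaling by x this is the value of
  -- the original polynomial at x.
  ∑-rescale : ∀ as x → ∑ (rescale as x) ≡ evalσ as x
  ∑-rescale []       x = refl
  ∑-rescale (a ∷ as) x = cong (a ⊗ x ⊕_) (∑-rescale as (σ x))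

  -- The quotient of a₀ − c + Σ aᵢ σⁱ by σ − 1 on the right, when a₀ + Σ aᵢ = c.
  quotient : Carrier → Carrier → List Carrier → List Carrier
  quotient c a []       = []
  quotient c a (b ∷ bs) = c ⊝ a ∷ quotient (c ⊝ a) b bs

  length-quotient : ∀ c a as → length (quotient c a as) ≡ length as
  length-quotient c a []       = refl
  length-quotient c a (b ∷ bs) = cong suc (length-quotient (c ⊝ a) b bs)

  -- Right division by σ - 1 with remainder c. A general remainder is needed for the recursion: the
  -- coefficients of the tail sum to c - a.
  evalσ-quotient : ∀ c a as t → ∑ (a ∷ as) ≡ c →
    evalσ (a ∷ as) t ≡ evalσ (quotient c a as) (σ t ⊝ t) ⊕ c ⊗ t
  evalσ-quotient c a [] t refl = trans (+-comm _ _) (cong (λ z → 0# ⊕ z ⊗ t) (sym (+-identityʳ a)))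
  evalσ-quotient c a (b ∷ bs) t refl = begin
    a ⊗ t ⊕ evalσ (b ∷ bs) (σ t)
      ≡⟨ cong (a ⊗ t ⊕_) (evalσ-quotient d b bs (σ t) Σ≡d) ⟩
    a ⊗ t ⊕ (evalσ h (σ (σ t) ⊝ σ t) ⊕ d ⊗ σ t)
      ≡⟨ cong (λ z → a ⊗ t ⊕ (evalσ h z ⊕ d ⊗ σ t)) (sym (σ-⊝ (σ t) t)) ⟩
    a ⊗ t ⊕ (evalσ h (σ (σ t ⊝ t)) ⊕ d ⊗ σ t)
      ≡⟨ solve 5 (λ a s t z c → a :* t :+ (z :+ (c :- a) :* s) := ((c :- a) :* (s :- t) :+ z) :+ c :* t) refl
           a (σ t) t (evalσ h (σ (σ t ⊝ t))) c ⟩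
    (d ⊗ (σ t ⊝ t) ⊕ evalσ h (σ (σ t ⊝ t))) ⊕ c ⊗ t ∎
    where
    d = c ⊝ a
    h = quotient d b bs
    Σ≡d : ∑ (b ∷ bs) ≡ d
    Σ≡d = solve 2 (λ a z → z := (a :+ z) :- a) refl a (∑ (b ∷ bs))

  -- For c = 0 the quotient lists the negated proper partial sums; if these and the total vanish, so
  -- does every coefficient.
  quotient-zero : ∀ c a as → c ≡ 0# → ∑ (a ∷ as) ≡ c → All (_≡ 0#) (quotient c a as) → All (_≡ 0#) (a ∷ as)
  quotient-zero c a []       refl eq []       = trans (sym (+-identityʳ a)) eq ∷ []
  quotient-zero c a (b ∷ bs) refl eq (p ∷ ps) =
    sym (x⊝y≡0⇒x≡y p) ∷ quotient-zero (0# ⊝ a) b bs p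
      (trans (solve 2 (λ a z → z := (a :+ z) :- a) refl a (∑ (b ∷ bs))) (cong (_⊝ a) eq)) ps

  module _ {x : Carrier} (x≢0 : x ≢ 0#) where

    -- The map t ↦ (σ - 1)(x⁻¹ t), linear over F_q, whose kernel is the line F_q x.
    δ : Carrier → Carrier
    δ t = σ (inv x≢0 ⊗ t) ⊝ inv x≢0 ⊗ t

    δ-⊝ : ∀ s t → δ (s ⊝ t) ≡ δ s ⊝ δ t
    δ-⊝ s t = begin
      σ (i ⊗ (s ⊝ t)) ⊝ i ⊗ (s ⊝ t)            ≡⟨ cong (λ z → σ z ⊝ z) i-⊝ ⟩
      σ (i ⊗ s ⊝ i ⊗ t) ⊝ (i ⊗ s ⊝ i ⊗ t)      ≡⟨ cong (_⊝ (i ⊗ s ⊝ i ⊗ t)) (σ-⊝ (i ⊗ s) (i ⊗ t)) ⟩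
      (σ (i ⊗ s) ⊝ σ (i ⊗ t)) ⊝ (i ⊗ s ⊝ i ⊗ t)
        ≡⟨ solve 4 (λ a b c d → (a :- b) :- (c :- d) := (a :- c) :- (b :- d)) refl (σ (i ⊗ s)) (σ (i ⊗ t)) (i ⊗ s) (i ⊗ t) ⟩
      δ s ⊝ δ t                                ∎
      where
      i = inv x≢0
      i-⊝ : i ⊗ (s ⊝ t) ≡ i ⊗ s ⊝ i ⊗ t
      i-⊝ = solve 3 (λ i s t → i :* (s :- t) := i :* s :- i :* t) refl i s t

    δ-scale-⊕ : ∀ {c} s t → Fixed c → δ (c ⊗ s ⊕ t) ≡ c ⊗ δ s ⊕ δ t
    δ-scale-⊕ {c} s t fc = begin
      σ (i ⊗ (c ⊗ s ⊕ t)) ⊝ i ⊗ (c ⊗ s ⊕ t)                   ≡⟨ cong (λ z → σ z ⊝ z) (solve 4 (λ i c s t → i :* (c :* s :+ t) := c :* (i :* s) :+ i :* t) refl i c s t) ⟩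
      σ (c ⊗ (i ⊗ s) ⊕ i ⊗ t) ⊝ (c ⊗ (i ⊗ s) ⊕ i ⊗ t)         ≡⟨ cong (_⊝ (c ⊗ (i ⊗ s) ⊕ i ⊗ t)) (trans (σ-⊕ _ _) (cong (_⊕ σ (i ⊗ t)) (trans (σ-⊗ _ _) (cong (_⊗ σ (i ⊗ s)) fc)))) ⟩
      (c ⊗ σ (i ⊗ s) ⊕ σ (i ⊗ t)) ⊝ (c ⊗ (i ⊗ s) ⊕ i ⊗ t)     ≡⟨ solve 5 (λ c a b d e → (c :* a :+ b) :- (c :* d :+ e) := c :* (a :- d) :+ (b :- e)) refl c (σ (i ⊗ s)) (σ (i ⊗ t)) (i ⊗ s) (i ⊗ t) ⟩
      c ⊗ δ s ⊕ δ t                                           ∎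
      where i = inv x≢0

    δ-0 : δ 0# ≡ 0#
    δ-0 = x≡y⇒x⊝y≡0 (trans (cong σ (zeroʳ _)) (trans σ-0 (sym (zeroʳ _))))

    δ≡0 : ∀ {t} → δ t ≡ 0# → ∃[ c ] (Fixed c × t ≡ c ⊗ x)
    δ≡0 {t} eq = inv x≢0 ⊗ t , x⊝y≡0⇒x≡y eq , (begin
      t                      ≡⟨ *-identityʳ t ⟨
      t ⊗ 1#                 ≡⟨ cong (t ⊗_) (inv-inverseˡ x≢0) ⟨
      t ⊗ (inv x≢0 ⊗ x)      ≡⟨ solve 3 (λ t i x → t :* (i :* x) := (i :* t) :* x) refl t (inv x≢0) x ⟩
      inv x≢0 ⊗ t ⊗ x        ∎)

    span-map-δ : ∀ xs {w} → Span (map δ xs) w → ∃[ v ] (Span xs v × w ≡ δ v)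
    span-map-δ [] [] = 0# , [] , sym δ-0
    span-map-δ (y ∷ ys) (_∷_ {c} fc Sw) with span-map-δ ys Sw
    ... | v , Sv , refl = c ⊗ y ⊕ v , fc ∷ Sv , sym (δ-scale-⊕ y v fc)

    -- A relation among the images lifts to y - v = c x. If c = 0 it contradicts the independence of
    -- y from the rest; otherwise it can be solved for x.
    independent-map-δ : ∀ xs → Independent (x ∷ xs) → Independent (map δ xs)
    independent-map-δ [] _ = []
    independent-map-δ (y ∷ ys) (x∉ ∷ (y∉ ∷ ind)) =
      δy∉ ∷ independent-map-δ ys ((λ x∈ → x∉ (span-weaken x∈)) ∷ ind)
      where
      δy∉ : ¬ Span (map δ ys) (δ y)
      δy∉ δy∈ =
        let v , Sv , eq = span-map-δ ys δy∈
            c , fc , y⊝v≡cx = δ≡0 (trans (δ-⊝ y v) (x≡y⇒x⊝y≡0 eq))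
        in contradiction-by Sv fc y⊝v≡cx (c ≟ 0#)
        where
        contradiction-by : ∀ {v c} → Span ys v → Fixed c → y ⊝ v ≡ c ⊗ x → Dec (c ≡ 0#) → ⊥
        contradiction-by Sv fc eq (yes refl) = y∉ (subst (Span ys) (sym (x⊝y≡0⇒x≡y (trans eq (zeroˡ x)))) Sv)
        contradiction-by Sv fc eq (no c≢0)   = x∉ (span-solve fc c≢0 (span-⊝ span-head (span-weaken Sv)) (sym eq))

  -- Substituting x₀ t for t makes 1 a root, so that σ − 1 splits off on the right and the
  -- number of coefficients and of independent roots both drop by one.
  too-many-roots : ∀ k as xs → length as ≡ k → length xs ≡ k → Independent xs →
    (∀ {x} → x ∈ xs → evalσ as x ≡ 0#) → All (_≡ 0#) as
  too-many-roots zero    []       []       _ _ _ _ = []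
  too-many-roots (suc k) (a ∷ as) (x ∷ xs) ∣as∣ ∣xs∣ ind roots =
    rescale-zero (a ∷ as) x≢0 (quotient-zero 0# (a ⊗ x) bs refl Σ≡0
      (too-many-roots k h (map (δ x≢0) xs) ∣h∣ (trans (length-map (δ x≢0) xs) (ℕₚ.suc-injective ∣xs∣)) (independent-map-δ x≢0 xs ind) roots′))
    where
    x≢0 = independent-head-≢0 ind
    i   = inv x≢0
    bs  = rescale as (σ x)
    h   = quotient 0# (a ⊗ x) bs
    Σ≡0 : ∑ (a ⊗ x ∷ bs) ≡ 0#
    Σ≡0 = trans (∑-rescale (a ∷ as) x) (roots (here refl))
    ∣h∣ : length h ≡ k
    ∣h∣ = trans (length-quotient 0# (a ⊗ x) bs) (trans (length-rescale as (σ x)) (ℕₚ.suc-injective ∣as∣))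
    roots′ : ∀ {y} → y ∈ map (δ x≢0) xs → evalσ h y ≡ 0#
    roots′ y∈ with ∈-map⁻ (δ x≢0) y∈
    ... | t , t∈ , refl = begin
      evalσ h (δ x≢0 t)                       ≡⟨ +-identityʳ _ ⟨
      evalσ h (δ x≢0 t) ⊕ 0#                  ≡⟨ cong (evalσ h (δ x≢0 t) ⊕_) (zeroˡ (i ⊗ t)) ⟨
      evalσ h (δ x≢0 t) ⊕ 0# ⊗ (i ⊗ t)        ≡⟨ evalσ-quotient 0# (a ⊗ x) bs (i ⊗ t) Σ≡0 ⟨
      evalσ (rescale (a ∷ as) x) (i ⊗ t)      ≡⟨ evalσ-rescale (a ∷ as) x (i ⊗ t) ⟩
      evalσ (a ∷ as) (x ⊗ (i ⊗ t))            ≡⟨ cong (evalσ (a ∷ as)) (trans (sym (*-assoc x i t)) (trans (cong (_⊗ t) (inv-inverseʳ x≢0)) (*-identityˡ t))) ⟩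
      evalσ (a ∷ as) t                        ≡⟨ roots (there t∈) ⟩
      0#                                      ∎

-- Boolean conjunctions over a list

T-∧⁻ : ∀ {a b} → T (a ∧ b) → T a × T b
T-∧⁻ {true} {true} _ = tt , tt

T-∧⁺ : ∀ {a b} → T a → T b → T (a ∧ b)
T-∧⁺ {true} {true} _ _ = tt

T-foldr-∧⁻ : ∀ {a} {A : Set a} (p : A → Bool) xs → T (foldr (λ x acc → acc ∧ p x) true xs) →
  ∀ {x} → x ∈ xs → T (p x)
T-foldr-∧⁻ p (x ∷ xs) h (here refl) = proj₂ (T-∧⁻ {foldr (λ x acc → acc ∧ p x) true xs} h)
T-foldr-∧⁻ p (x ∷ xs) h (there x∈)  = T-foldr-∧⁻ p xs (proj₁ (T-∧⁻ {foldr (λ x acc → acc ∧ p x) true xs} h)) x∈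

T-foldr-∧⁺ : ∀ {a} {A : Set a} (p : A → Bool) xs → (∀ x → T (p x)) → T (foldr (λ x acc → acc ∧ p x) true xs)
T-foldr-∧⁺ p []       h = tt
T-foldr-∧⁺ p (x ∷ xs) h = T-∧⁺ {foldr (λ x acc → acc ∧ p x) true xs} (T-foldr-∧⁺ p xs h) (h x)

-- The polynomials F and the equation for G

module Kernel {q n : ℕ} (K : FiniteField q n) (generator : GaloisGenerator K) where

  open FieldTheory K
  open ScalarField K
  open SpanTheory K generator public
  open ≡-Reasoning

  Coeffs : Set
  Coeffs = Carrier × Carrier × Carrier

  F : Coeffs → Carrier → Carrier
  F (b₀ , b₁ , b₂) x = b₀ ⊗ x ⊕ (b₁ ⊗ σ x ⊕ τ (b₁ ⊗ x)) ⊕ (b₂ ⊗ σ (σ x) ⊕ τ (τ (b₂ ⊗ x)))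

  ττ-⊗ : ∀ x y → τ (τ (x ⊗ y)) ≡ τ (τ x) ⊗ τ (τ y)
  ττ-⊗ x y = trans (cong τ (τ-⊗ x y)) (τ-⊗ (τ x) (τ y))

  F-expand : ∀ b₀ b₁ b₂ x → F (b₀ , b₁ , b₂) x ≡
    b₀ ⊗ x ⊕ (b₁ ⊗ σ x ⊕ τ b₁ ⊗ τ x) ⊕ (b₂ ⊗ σ (σ x) ⊕ τ (τ b₂) ⊗ τ (τ x))
  F-expand b₀ b₁ b₂ x = cong₂ (λ s t → b₀ ⊗ x ⊕ (b₁ ⊗ σ x ⊕ s) ⊕ (b₂ ⊗ σ (σ x) ⊕ t)) (τ-⊗ b₁ x) (ττ-⊗ b₂ x)

  F-0 : ∀ b → F b 0# ≡ 0#
  F-0 (b₀ , b₁ , b₂) = begin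
    F (b₀ , b₁ , b₂) 0#
      ≡⟨ F-expand b₀ b₁ b₂ 0# ⟩
    b₀ ⊗ 0# ⊕ (b₁ ⊗ σ 0# ⊕ τ b₁ ⊗ τ 0#) ⊕ (b₂ ⊗ σ (σ 0#) ⊕ τ (τ b₂) ⊗ τ (τ 0#))
      ≡⟨ cong₂ _⊕_ (cong₂ _⊕_ (zeroʳ _) (cong₂ _⊕_ (at-0 σ-0) (at-0 τ-0)))
           (cong₂ _⊕_ (at-0 (trans (cong σ σ-0) σ-0)) (at-0 (trans (cong τ τ-0) τ-0))) ⟩
    0# ⊕ (0# ⊕ 0#) ⊕ (0# ⊕ 0#)
      ≡⟨ cong₂ (λ s t → 0# ⊕ s ⊕ t) (+-identityˡ 0#) (+-identityˡ 0#) ⟩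
    0# ⊕ 0# ⊕ 0#
      ≡⟨ trans (+-identityʳ _) (+-identityˡ 0#) ⟩
    0# ∎
    where
    at-0 : ∀ {a b} → b ≡ 0# → a ⊗ b ≡ 0#
    at-0 {a} refl = zeroʳ a

  F-linear : ∀ b {c} x y → Fixed c → F b (c ⊗ x ⊕ y) ≡ c ⊗ F b x ⊕ F b y
  F-linear (b₀ , b₁ , b₂) {c} x y fc = begin
    F b (c ⊗ x ⊕ y)
      ≡⟨ F-expand b₀ b₁ b₂ (c ⊗ x ⊕ y) ⟩
    b₀ ⊗ (c ⊗ x ⊕ y) ⊕ (b₁ ⊗ σ (c ⊗ x ⊕ y) ⊕ τ b₁ ⊗ τ (c ⊗ x ⊕ y)) ⊕
      (b₂ ⊗ σ (σ (c ⊗ x ⊕ y)) ⊕ τ (τ b₂) ⊗ τ (τ (c ⊗ x ⊕ y)))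
      ≡⟨ cong₂ (λ s t → b₀ ⊗ (c ⊗ x ⊕ y) ⊕ s ⊕ t)
           (cong₂ (λ s t → b₁ ⊗ s ⊕ τ b₁ ⊗ t) (σ-lin x y) (τ-lin x y))
           (cong₂ (λ s t → b₂ ⊗ s ⊕ τ (τ b₂) ⊗ t) (trans (cong σ (σ-lin x y)) (σ-lin (σ x) (σ y)))
             (trans (cong τ (τ-lin x y)) (τ-lin (τ x) (τ y)))) ⟩
    b₀ ⊗ (c ⊗ x ⊕ y) ⊕ (b₁ ⊗ (c ⊗ σ x ⊕ σ y) ⊕ τ b₁ ⊗ (c ⊗ τ x ⊕ τ y)) ⊕
      (b₂ ⊗ (c ⊗ σ (σ x) ⊕ σ (σ y)) ⊕ τ (τ b₂) ⊗ (c ⊗ τ (τ x) ⊕ τ (τ y)))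
      ≡⟨ cong₂ _⊕_ (cong₂ _⊕_ (dist b₀ x y) (dist₂ b₁ (σ x) (σ y) (τ b₁) (τ x) (τ y)))
           (dist₂ b₂ (σ (σ x)) (σ (σ y)) (τ (τ b₂)) (τ (τ x)) (τ (τ y))) ⟩
    (c ⊗ (b₀ ⊗ x) ⊕ b₀ ⊗ y) ⊕ (c ⊗ p₁ ⊕ p₁′) ⊕ (c ⊗ p₂ ⊕ p₂′)
      ≡⟨ solve 7 (λ c u u′ v v′ w w′ → (c :* u :+ u′) :+ (c :* v :+ v′) :+ (c :* w :+ w′)
           := c :* (u :+ v :+ w) :+ (u′ :+ v′ :+ w′)) refl c (b₀ ⊗ x) (b₀ ⊗ y) p₁ p₁′ p₂ p₂′ ⟩
    c ⊗ (b₀ ⊗ x ⊕ p₁ ⊕ p₂) ⊕ (b₀ ⊗ y ⊕ p₁′ ⊕ p₂′)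
      ≡⟨ cong₂ (λ s t → c ⊗ s ⊕ t) (F-expand b₀ b₁ b₂ x) (F-expand b₀ b₁ b₂ y) ⟨
    c ⊗ F b x ⊕ F b y ∎
    where
    b  = b₀ , b₁ , b₂
    p₁ = b₁ ⊗ σ x ⊕ τ b₁ ⊗ τ x
    p₁′ = b₁ ⊗ σ y ⊕ τ b₁ ⊗ τ y
    p₂ = b₂ ⊗ σ (σ x) ⊕ τ (τ b₂) ⊗ τ (τ x)
    p₂′ = b₂ ⊗ σ (σ y) ⊕ τ (τ b₂) ⊗ τ (τ y)
    σ-lin : ∀ u v → σ (c ⊗ u ⊕ v) ≡ c ⊗ σ u ⊕ σ v
    σ-lin u v = trans (σ-⊕ _ _) (cong (_⊕ σ v) (trans (σ-⊗ c u) (cong (_⊗ σ u) fc)))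
    τ-lin : ∀ u v → τ (c ⊗ u ⊕ v) ≡ c ⊗ τ u ⊕ τ v
    τ-lin u v = trans (τ-⊕ _ _) (cong (_⊕ τ v) (trans (τ-⊗ c u) (cong (_⊗ τ u) (fixed-τ fc))))
    dist : ∀ a u v → a ⊗ (c ⊗ u ⊕ v) ≡ c ⊗ (a ⊗ u) ⊕ a ⊗ v
    dist a u v = solve 4 (λ c a u v → a :* (c :* u :+ v) := c :* (a :* u) :+ a :* v) refl c a u v
    dist₂ : ∀ a u v a′ u′ v′ → a ⊗ (c ⊗ u ⊕ v) ⊕ a′ ⊗ (c ⊗ u′ ⊕ v′) ≡ c ⊗ (a ⊗ u ⊕ a′ ⊗ u′) ⊕ (a ⊗ v ⊕ a′ ⊗ v′)
    dist₂ = solve 7 (λ c a u v a′ u′ v′ → a :* (c :* u :+ v) :+ a′ :* (c :* u′ :+ v′)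
      := c :* (a :* u :+ a′ :* u′) :+ (a :* v :+ a′ :* v′)) refl c

  F-span : ∀ b {xs} → (∀ {x} → x ∈ xs → F b x ≡ 0#) → ∀ {v} → Span xs v → F b v ≡ 0#
  F-span b h [] = F-0 b
  F-span b h (_∷_ {c} {x} {v} fc Sv) = trans (F-linear b x v fc)
    (trans (cong₂ (λ s t → c ⊗ s ⊕ t) (h (here refl)) (F-span b (h ∘ there) Sv))
      (trans (+-identityʳ _) (zeroʳ c)))

  -- The 2 × 2 Moore determinant, the σ-analogue of a Wronskian: it vanishes only if Y / Z is fixed
  -- by `σ`.
  wronskian-≢0 : ∀ {Y Z} → Independent (Y ∷ Z ∷ []) → Z ⊗ σ Y ⊝ Y ⊗ σ Z ≢ 0#
  wronskian-≢0 {Y} {Z} (Y∉ ∷ indZ) eq =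
    let c , fc , Y≡cZ = fixed-ratio (independent-head-≢0 indZ) (trans (x⊝y≡0⇒x≡y eq) (*-comm Y (σ Z)))
    in Y∉ (subst (Span (Z ∷ [])) (trans (+-identityʳ _) (sym Y≡cZ)) (fc ∷ []))

  G : Carrier → Carrier × Carrier → Carrier
  G Y (b₁ , b₂) = b₁ ⊗ Y ⊕ (b₂ ⊗ (σ Y ⊕ Y) ⊕ τ b₂ ⊗ (Y ⊕ τ Y))

  -- F y - y F 1 is the sum of v - τⁱ v for v = bᵢ (σⁱ y - y), i = 1, 2. The factorisation 1 - τ² =
  -- (1 - τ)(1 + τ) accounts for the two terms of `G` that contain b₂.
  F-G : ∀ b₀ b₁ b₂ y → let g = G (σ y ⊝ y) (b₁ , b₂) in
    F (b₀ , b₁ , b₂) y ≡ y ⊗ F (b₀ , b₁ , b₂) 1# ⊕ (g ⊝ τ g)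
  F-G b₀ b₁ b₂ y = begin
    F b y
      ≡⟨ F-expand b₀ b₁ b₂ y ⟩
    b₀ ⊗ y ⊕ (b₁ ⊗ σ y ⊕ τ b₁ ⊗ τ y) ⊕ (b₂ ⊗ σ (σ y) ⊕ τ (τ b₂) ⊗ τ (τ y))
      ≡⟨ regroup ⟩
    y ⊗ (b₀ ⊕ (b₁ ⊕ τ b₁) ⊕ (b₂ ⊕ τ (τ b₂))) ⊕
      (b₁ ⊗ (σ y ⊝ y) ⊝ τ b₁ ⊗ (y ⊝ τ y) ⊕ (b₂ ⊗ (σ (σ y) ⊝ y) ⊝ τ (τ b₂) ⊗ (y ⊝ τ (τ y))))
      ≡⟨ cong₂ (λ s t → y ⊗ s ⊕ t) F-1 g⊝τg ⟨
    y ⊗ F b 1# ⊕ (g ⊝ τ g) ∎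
    where
    b = b₀ , b₁ , b₂
    Y = σ y ⊝ y
    g = G Y (b₁ , b₂)
    regroup = solve 10 (λ b₀ b₁ b₁′ b₂ b₂″ y sy ssy ty tty →
      b₀ :* y :+ (b₁ :* sy :+ b₁′ :* ty) :+ (b₂ :* ssy :+ b₂″ :* tty) :=
      y :* (b₀ :+ (b₁ :+ b₁′) :+ (b₂ :+ b₂″)) :+
      (b₁ :* (sy :- y) :- b₁′ :* (y :- ty) :+ (b₂ :* (ssy :- y) :- b₂″ :* (y :- tty)))) refl
      b₀ b₁ (τ b₁) b₂ (τ (τ b₂)) y (σ y) (σ (σ y)) (τ y) (τ (τ y))
    F-1 : F b 1# ≡ b₀ ⊕ (b₁ ⊕ τ b₁) ⊕ (b₂ ⊕ τ (τ b₂))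
    F-1 = cong₂ _⊕_ (cong₂ _⊕_ (*-identityʳ b₀) (cong₂ _⊕_ (at-1 σ-1) (cong τ (*-identityʳ b₁))))
      (cong₂ _⊕_ (at-1 (trans (cong σ σ-1) σ-1)) (cong (τ ∘ τ) (*-identityʳ b₂)))
      where
      at-1 : ∀ {a c} → c ≡ 1# → a ⊗ c ≡ a
      at-1 {a} refl = *-identityʳ a
    σY : σ Y ≡ σ (σ y) ⊝ σ y
    σY = σ-⊝ (σ y) y
    τY : τ Y ≡ y ⊝ τ y
    τY = trans (τ-⊝ (σ y) y) (cong (_⊝ τ y) (τσ y))
    g≡ : g ≡ b₁ ⊗ (σ y ⊝ y) ⊕ (b₂ ⊗ (σ (σ y) ⊝ y) ⊕ τ b₂ ⊗ (σ y ⊝ τ y))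
    g≡ = cong₂ (λ s t → b₁ ⊗ Y ⊕ (b₂ ⊗ s ⊕ τ b₂ ⊗ t))
      (trans (cong (_⊕ Y) σY) (telescope (σ (σ y)) (σ y) y))
      (trans (cong (Y ⊕_) τY) (telescope (σ y) y (τ y)))
      where
      telescope : ∀ a b c → (a ⊝ b) ⊕ (b ⊝ c) ≡ a ⊝ c
      telescope = solve 3 (λ a b c → (a :- b) :+ (b :- c) := a :- c) refl
    τg≡ : τ g ≡ τ b₁ ⊗ (y ⊝ τ y) ⊕ (τ b₂ ⊗ (σ y ⊝ τ y) ⊕ τ (τ b₂) ⊗ (y ⊝ τ (τ y)))
    τg≡ = trans (cong τ g≡) (trans (τ-⊕ _ _) (cong₂ _⊕_
      (trans (τ-⊗ _ _) (cong (τ b₁ ⊗_) τY))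
      (trans (τ-⊕ _ _) (cong₂ _⊕_
        (trans (τ-⊗ _ _) (cong (τ b₂ ⊗_) (trans (τ-⊝ _ _) (cong (_⊝ τ y) (τσ (σ y))))))
        (trans (τ-⊗ _ _) (cong (τ (τ b₂) ⊗_) (trans (τ-⊝ _ _) (cong (_⊝ τ (τ y)) (τσ y)))))))))
    g⊝τg : g ⊝ τ g ≡ b₁ ⊗ (σ y ⊝ y) ⊝ τ b₁ ⊗ (y ⊝ τ y) ⊕ (b₂ ⊗ (σ (σ y) ⊝ y) ⊝ τ (τ b₂) ⊗ (y ⊝ τ (τ y)))
    g⊝τg = trans (cong₂ _⊝_ g≡ τg≡) (solve 5 (λ a b c d e → (a :+ (b :+ c)) :- (d :+ (c :+ e)) := a :- d :+ (b :- e)) refl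
      (b₁ ⊗ (σ y ⊝ y)) (b₂ ⊗ (σ (σ y) ⊝ y)) (τ b₂ ⊗ (σ y ⊝ τ y)) (τ b₁ ⊗ (y ⊝ τ y)) (τ (τ b₂) ⊗ (y ⊝ τ (τ y))))

  τ-invariant⇒fixed : ∀ {g} → g ⊝ τ g ≡ 0# → Fixed g
  τ-invariant⇒fixed {g} eq = trans (cong σ (x⊝y≡0⇒x≡y eq)) (στ g)

  -- The b₀ that makes 1 a root. `σ 1#` stays unevaluated so that the terms agree literally with
  -- those of `F` at 1.
  b₀-of : Carrier × Carrier → Carrier
  b₀-of (b₁ , b₂) = ⊖ ((b₁ ⊗ σ 1# ⊕ τ (b₁ ⊗ 1#)) ⊕ (b₂ ⊗ σ (σ 1#) ⊕ τ (τ (b₂ ⊗ 1#))))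

  F-at-1 : ∀ b₀ b₁ b₂ → F (b₀ , b₁ , b₂) 1# ≡ b₀ ⊝ b₀-of (b₁ , b₂)
  F-at-1 b₀ b₁ b₂ = trans (cong (λ z → z ⊕ s ⊕ t) (*-identityʳ b₀))
    (solve 3 (λ b s t → b :+ s :+ t := b :- :- (s :+ t)) refl b₀ s t)
    where
    s = b₁ ⊗ σ 1# ⊕ τ (b₁ ⊗ 1#)
    t = b₂ ⊗ σ (σ 1#) ⊕ τ (τ (b₂ ⊗ 1#))

  -- Replaces U by x⁻¹ U, so that 1 ∈ U may be assumed.
  twist : Carrier → Coeffs → Coeffs
  twist x (b₀ , b₁ , b₂) = x ⊗ x ⊗ b₀ , x ⊗ σ x ⊗ b₁ , x ⊗ σ (σ x) ⊗ b₂

  -- The outer factor x turns the substitution into a congruence of the symmetric form; without it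
  -- the coefficients would no longer occur in adjoint pairs.
  F-twist : ∀ x b t → F (twist x b) t ≡ F b (x ⊗ t) ⊗ x
  F-twist x (b₀ , b₁ , b₂) t = begin
    F (twist x (b₀ , b₁ , b₂)) t
      ≡⟨ cong₂ (λ u v → x ⊗ x ⊗ b₀ ⊗ t ⊕ (x ⊗ σ x ⊗ b₁ ⊗ σ t ⊕ u) ⊕ (x ⊗ σ (σ x) ⊗ b₂ ⊗ σ (σ t) ⊕ v)) τ-part ττ-part ⟩
    x ⊗ x ⊗ b₀ ⊗ t ⊕ (x ⊗ σ x ⊗ b₁ ⊗ σ t ⊕ p ⊗ x) ⊕ (x ⊗ σ (σ x) ⊗ b₂ ⊗ σ (σ t) ⊕ r ⊗ x)
      ≡⟨ solve 11 (λ x t b₀ sx st b₁ ssx sst b₂ p r → x :* x :* b₀ :* t :+ (x :* sx :* b₁ :* st :+ p :* x) :+ (x :* ssx :* b₂ :* sst :+ r :* x)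
           := (b₀ :* (x :* t) :+ (b₁ :* (sx :* st) :+ p) :+ (b₂ :* (ssx :* sst) :+ r)) :* x) refl x t b₀ (σ x) (σ t) b₁ (σ (σ x)) (σ (σ t)) b₂ p r ⟩
    (b₀ ⊗ (x ⊗ t) ⊕ (b₁ ⊗ (σ x ⊗ σ t) ⊕ p) ⊕ (b₂ ⊗ (σ (σ x) ⊗ σ (σ t)) ⊕ r)) ⊗ x
      ≡⟨ cong₂ (λ u v → (b₀ ⊗ (x ⊗ t) ⊕ (b₁ ⊗ u ⊕ p) ⊕ (b₂ ⊗ v ⊕ r)) ⊗ x) (σ-⊗ x t) (trans (cong σ (σ-⊗ x t)) (σ-⊗ (σ x) (σ t))) ⟨
    F (b₀ , b₁ , b₂) (x ⊗ t) ⊗ x ∎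
    where
    p = τ (b₁ ⊗ (x ⊗ t))
    r = τ (τ (b₂ ⊗ (x ⊗ t)))
    τ-part : τ (x ⊗ σ x ⊗ b₁ ⊗ t) ≡ p ⊗ x
    τ-part = trans (cong τ (solve 4 (λ x sx b t → x :* sx :* b :* t := (b :* (x :* t)) :* sx) refl x (σ x) b₁ t))
      (trans (τ-⊗ _ _) (cong (p ⊗_) (τσ x)))
    ττ-part : τ (τ (x ⊗ σ (σ x) ⊗ b₂ ⊗ t)) ≡ r ⊗ x
    ττ-part = trans (cong (τ ∘ τ) (solve 4 (λ x sx b t → x :* sx :* b :* t := (b :* (x :* t)) :* sx) refl x (σ (σ x)) b₂ t))
      (trans (ττ-⊗ _ _) (cong (r ⊗_) (trans (cong τ (τσ (σ x))) (τσ x))))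

  twist-inverse : ∀ {x y} → y ⊗ x ≡ 1# → ∀ b → twist y (twist x b) ≡ b
  twist-inverse {x} {y} yx≡1 (b₀ , b₁ , b₂) = cong₂ _,_ (cancel yx≡1 b₀) (cong₂ _,_ (cancel σyσx≡1 b₁) (cancel (trans (sym (σ-⊗ _ _)) (trans (cong σ σyσx≡1) σ-1)) b₂))
    where
    σyσx≡1 : σ y ⊗ σ x ≡ 1#
    σyσx≡1 = trans (sym (σ-⊗ y x)) (trans (cong σ yx≡1) σ-1)
    cancel : ∀ {v w} → v ⊗ w ≡ 1# → ∀ b → y ⊗ v ⊗ (x ⊗ w ⊗ b) ≡ b
    cancel {v} {w} eq b = begin
      y ⊗ v ⊗ (x ⊗ w ⊗ b)    ≡⟨ solve 5 (λ y v x w b → y :* v :* (x :* w :* b) := (y :* x) :* (v :* w) :* b) refl y v x w b ⟩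
      y ⊗ x ⊗ (v ⊗ w) ⊗ b    ≡⟨ cong₂ (λ s t → s ⊗ t ⊗ b) yx≡1 eq ⟩
      1# ⊗ 1# ⊗ b            ≡⟨ trans (*-assoc _ _ _) (trans (*-identityˡ _) (*-identityˡ b)) ⟩
      b                      ∎

  module _ {Y : Carrier} (Y≢0 : Y ≢ 0#) where

    b₁-of : Carrier → Carrier → Carrier
    b₁-of c b₂ = (c ⊝ G Y (0# , b₂)) ⊗ inv Y≢0

    G-split : ∀ b₁ b₂ → G Y (b₁ , b₂) ≡ b₁ ⊗ Y ⊕ G Y (0# , b₂)
    G-split b₁ b₂ = cong (b₁ ⊗ Y ⊕_) (sym (trans (cong (_⊕ _) (zeroˡ Y)) (+-identityˡ _)))

    G-b₁-of : ∀ c b₂ → G Y (b₁-of c b₂ , b₂) ≡ c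
    G-b₁-of c b₂ = begin
      G Y (b₁-of c b₂ , b₂)                ≡⟨ G-split (b₁-of c b₂) b₂ ⟩
      (c ⊝ e) ⊗ inv Y≢0 ⊗ Y ⊕ e            ≡⟨ cong (_⊕ e) (trans (*-assoc _ _ _) (trans (cong ((c ⊝ e) ⊗_) (inv-inverseˡ Y≢0)) (*-identityʳ _))) ⟩
      c ⊝ e ⊕ e                            ≡⟨ solve 2 (λ c e → c :- e :+ e := c) refl c e ⟩
      c                                    ∎
      where e = G Y (0# , b₂)

    b₁-of-G : ∀ b₁ b₂ → b₁-of (G Y (b₁ , b₂)) b₂ ≡ b₁
    b₁-of-G b₁ b₂ = ⊗-cancelˡ Y≢0 (begin
      Y ⊗ ((g ⊝ e) ⊗ inv Y≢0)              ≡⟨ solve 3 (λ y d i → y :* (d :* i) := d :* (i :* y)) refl Y (g ⊝ e) (inv Y≢0) ⟩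
      (g ⊝ e) ⊗ (inv Y≢0 ⊗ Y)              ≡⟨ cong ((g ⊝ e) ⊗_) (inv-inverseˡ Y≢0) ⟩
      (g ⊝ e) ⊗ 1#                         ≡⟨ *-identityʳ _ ⟩
      g ⊝ e                                ≡⟨ cong (_⊝ e) (G-split b₁ b₂) ⟩
      b₁ ⊗ Y ⊕ e ⊝ e                       ≡⟨ solve 3 (λ b y e → b :* y :+ e :- e := y :* b) refl b₁ Y e ⟩
      Y ⊗ b₁                               ∎)
      where
      g = G Y (b₁ , b₂)
      e = G Y (0# , b₂)

  -- The coefficients of σ² F

  -- The coefficients of σ² ∘ F b as a polynomial in σ; composing with σ² clears the inverses of σ.
  F-coefficients : Coeffs → List Carrier
  F-coefficients (b₀ , b₁ , b₂) = b₂ ∷ σ b₁ ∷ σ (σ b₀) ∷ σ (σ b₁) ∷ σ (σ b₂) ∷ []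

  evalσ-F : ∀ b x → evalσ (F-coefficients b) x ≡ σ (σ (F b x))
  evalσ-F (b₀ , b₁ , b₂) x = begin
    b₂ ⊗ x ⊕ (σ b₁ ⊗ x₁ ⊕ (σ (σ b₀) ⊗ x₂ ⊕ (σ (σ b₁) ⊗ x₃ ⊕ (σ (σ b₂) ⊗ x₄ ⊕ 0#))))
      ≡⟨ cong (λ v → b₂ ⊗ x ⊕ (σ b₁ ⊗ x₁ ⊕ (σ (σ b₀) ⊗ x₂ ⊕ (σ (σ b₁) ⊗ x₃ ⊕ v)))) (+-identityʳ _) ⟩
    b₂ ⊗ x ⊕ (σ b₁ ⊗ x₁ ⊕ (σ (σ b₀) ⊗ x₂ ⊕ (σ (σ b₁) ⊗ x₃ ⊕ σ (σ b₂) ⊗ x₄)))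
      ≡⟨ solve 5 (λ a b c d e → a :+ (b :+ (c :+ (d :+ e))) := c :+ (d :+ b) :+ (e :+ a)) refl
           (b₂ ⊗ x) (σ b₁ ⊗ x₁) (σ (σ b₀) ⊗ x₂) (σ (σ b₁) ⊗ x₃) (σ (σ b₂) ⊗ x₄) ⟩
    σ (σ b₀) ⊗ x₂ ⊕ (σ (σ b₁) ⊗ x₃ ⊕ σ b₁ ⊗ x₁) ⊕ (σ (σ b₂) ⊗ x₄ ⊕ b₂ ⊗ x)
      ≡⟨ cong₂ _⊕_ (cong₂ _⊕_ (σσ-⊗ b₀ x) (cong₂ _⊕_ (σσ-⊗ b₁ x₁) (trans (cong σ (στ (b₁ ⊗ x))) (σ-⊗ b₁ x))))
           (cong₂ _⊕_ (σσ-⊗ b₂ x₂) (trans (cong σ (στ (τ (b₂ ⊗ x)))) (στ (b₂ ⊗ x)))) ⟨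
    σ (σ (b₀ ⊗ x)) ⊕ (σ (σ (b₁ ⊗ σ x)) ⊕ σ (σ (τ (b₁ ⊗ x)))) ⊕ (σ (σ (b₂ ⊗ σ (σ x))) ⊕ σ (σ (τ (τ (b₂ ⊗ x)))))
      ≡⟨ trans (σσ-⊕ _ _) (cong₂ _⊕_ (trans (σσ-⊕ _ _) (cong (_ ⊕_) (σσ-⊕ _ _))) (σσ-⊕ _ _)) ⟨
    σ (σ (F (b₀ , b₁ , b₂) x)) ∎
    where
    x₁ = σ x
    x₂ = σ x₁
    x₃ = σ x₂
    x₄ = σ x₃
    σσ-⊗ : ∀ x y → σ (σ (x ⊗ y)) ≡ σ (σ x) ⊗ σ (σ y)
    σσ-⊗ x y = trans (cong σ (σ-⊗ x y)) (σ-⊗ (σ x) (σ y))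
    σσ-⊕ : ∀ x y → σ (σ (x ⊕ y)) ≡ σ (σ x) ⊕ σ (σ y)
    σσ-⊕ x y = trans (cong σ (σ-⊕ x y)) (σ-⊕ (σ x) (σ y))

  evalσ-append-0 : ∀ as x → evalσ (as ++ 0# ∷ []) x ≡ evalσ as x
  evalσ-append-0 []       x = trans (+-identityʳ _) (zeroˡ x)
  evalσ-append-0 (a ∷ as) x = cong (a ⊗ x ⊕_) (evalσ-append-0 as (σ x))

  evalσ-zipWith : ∀ d as bs → length as ≡ length bs → ∀ x →
    evalσ (zipWith (λ u v → u ⊝ d ⊗ v) as bs) x ≡ evalσ as x ⊝ d ⊗ evalσ bs x
  evalσ-zipWith d []       []       _   x = sym (x≡y⇒x⊝y≡0 (sym (zeroʳ d)))
  evalσ-zipWith d (a ∷ as) (b ∷ bs) len x = trans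
    (cong ((a ⊝ d ⊗ b) ⊗ x ⊕_) (evalσ-zipWith d as bs (ℕₚ.suc-injective len) (σ x)))
    (solve 6 (λ a b d x s t → (a :- d :* b) :* x :+ (s :- d :* t) := (a :* x :+ s) :- d :* (b :* x :+ t)) refl
      a b d x (evalσ as (σ x)) (evalσ bs (σ x)))

  0-coeffs : Coeffs
  0-coeffs = 0# , 0# , 0#

  σσ≡0 : ∀ {x} → σ (σ x) ≡ 0# → x ≡ 0#
  σσ≡0 eq = σ-injective (σ-injective (trans eq (sym (trans (cong σ σ-0) σ-0))))

  F-scale : ∀ {c} b x → Fixed c → F (c ⊗ proj₁ b , c ⊗ proj₁ (proj₂ b) , c ⊗ proj₂ (proj₂ b)) x ≡ c ⊗ F b x
  F-scale {c} (b₀ , b₁ , b₂) x fc = begin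
    c ⊗ b₀ ⊗ x ⊕ (c ⊗ b₁ ⊗ σ x ⊕ τ (c ⊗ b₁ ⊗ x)) ⊕ (c ⊗ b₂ ⊗ σ (σ x) ⊕ τ (τ (c ⊗ b₂ ⊗ x)))
      ≡⟨ cong₂ (λ s t → c ⊗ b₀ ⊗ x ⊕ (c ⊗ b₁ ⊗ σ x ⊕ s) ⊕ (c ⊗ b₂ ⊗ σ (σ x) ⊕ t)) (τ-scale b₁)
           (trans (cong τ (τ-scale b₂)) (trans (τ-⊗ _ _) (cong (_⊗ τ (τ (b₂ ⊗ x))) (fixed-τ fc)))) ⟩
    c ⊗ b₀ ⊗ x ⊕ (c ⊗ b₁ ⊗ σ x ⊕ c ⊗ τ (b₁ ⊗ x)) ⊕ (c ⊗ b₂ ⊗ σ (σ x) ⊕ c ⊗ τ (τ (b₂ ⊗ x)))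
      ≡⟨ solve 9 (λ c b₀ x b₁ sx p b₂ ssx r → c :* b₀ :* x :+ (c :* b₁ :* sx :+ c :* p) :+ (c :* b₂ :* ssx :+ c :* r)
           := c :* (b₀ :* x :+ (b₁ :* sx :+ p) :+ (b₂ :* ssx :+ r))) refl c b₀ x b₁ (σ x) (τ (b₁ ⊗ x)) b₂ (σ (σ x)) (τ (τ (b₂ ⊗ x))) ⟩
    c ⊗ F (b₀ , b₁ , b₂) x ∎
    where
    τ-scale : ∀ b → τ (c ⊗ b ⊗ x) ≡ c ⊗ τ (b ⊗ x)
    τ-scale b = trans (cong τ (*-assoc c b x)) (trans (τ-⊗ c (b ⊗ x)) (cong (_⊗ τ (b ⊗ x)) (fixed-τ fc)))

  F-0-coeffs : ∀ x → F 0-coeffs x ≡ 0#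
  F-0-coeffs x = begin
    F 0-coeffs x                                         ≡⟨ cong (λ b → F b x) (cong₂ _,_ (zeroˡ 0#) (cong₂ _,_ (zeroˡ 0#) (zeroˡ 0#))) ⟨
    F (0# ⊗ 0# , 0# ⊗ 0# , 0# ⊗ 0#) x                    ≡⟨ F-scale 0-coeffs x σ-0 ⟩
    0# ⊗ F 0-coeffs x                                    ≡⟨ zeroˡ _ ⟩
    0#                                                   ∎

  σσ-cancel : ∀ {c a b} → σ (σ b) ≡ σ (σ c) ⊗ σ (σ a) → b ≡ c ⊗ a
  σσ-cancel {c} {a} eq = σ-injective (σ-injective (trans eq
    (sym (trans (cong σ (σ-⊗ c a)) (σ-⊗ (σ c) (σ a))))))

  -- Counting the polynomials that vanish on U

  module _ (s : ℕ) (polyS≡F : ∀ b x → polyS K s b x ≡ F b x) {u : ℕ} (W : Subspace K u) where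

    open Subspace W

    Vanishes : Coeffs → Set
    Vanishes b = ∀ {x} → U x → F b x ≡ 0#

    triples : List Coeffs
    triples = cartesianProduct elems (cartesianProduct elems elems)

    private
      good : Coeffs → Carrier → Bool
      good b x = not ⌊ U? x ⌋ ∨ ⌊ polyS K s b x ≟ 0# ⌋

      vanishes : Coeffs → Bool
      vanishes b = foldr (λ x acc → acc ∧ good b x) true elems

      vanishes⇒ : ∀ b → T (vanishes b) → Vanishes b
      vanishes⇒ b h {x} Ux = trans (sym (polyS≡F b x)) (extract (T-foldr-∧⁻ (good b) elems h (∈-elems x)))
        where
        extract : T (good b x) → polyS K s b x ≡ 0#
        extract h with U? x
        ... | yes _  = toWitness h
        ... | no ¬Ux = contradiction Ux ¬Ux

      vanishes⇐ : ∀ b → Vanishes b → T (vanishes b)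
      vanishes⇐ b h = T-foldr-∧⁺ (good b) elems each
        where
        each : ∀ x → T (good b x)
        each x with U? x
        ... | yes Ux = fromWitness (trans (polyS≡F b x) (h Ux))
        ... | no _   = tt

    -- Built with the same Boolean test as `kerCount`, so that its length is `kerCount K s W` by
    -- computation.
    kernel : List Coeffs
    kernel = filter (T? ∘ vanishes) triples

    ∈-kernel : ∀ {b} → Vanishes b → b ∈ kernel
    ∈-kernel {b} h = ∈-filter⁺ (T? ∘ vanishes)
      (∈-cartesianProduct⁺ (∈-elems _) (∈-cartesianProduct⁺ (∈-elems _) (∈-elems _))) (vanishes⇐ b h)

    kernel⇒Vanishes : ∀ {b} → b ∈ kernel → Vanishes b
    kernel⇒Vanishes {b} b∈ = vanishes⇒ b (proj₂ (∈-filter⁻ (T? ∘ vanishes) {xs = triples} b∈))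

    kernel-unique : Unique kernel
    kernel-unique = Uniqueₚ.filter⁺ (T? ∘ vanishes)
      (Uniqueₚ.cartesianProduct⁺ elems-unique (Uniqueₚ.cartesianProduct⁺ elems-unique elems-unique))

    -- The hypotheses make `f` and `g` mutually inverse between `ps` and the kernel, so its size is
    -- found without a basis of it.
    kerCount-parametrised : ∀ {P : Set} (ps : List P) → Unique ps → (f : P → Coeffs) (g : Coeffs → P) →
      (∀ {p} → p ∈ ps → Vanishes (f p)) → (∀ {p} → p ∈ ps → g (f p) ≡ p) →
      (∀ {b} → Vanishes b → g b ∈ ps) → (∀ {b} → Vanishes b → f (g b) ≡ b) →
      kerCount K s W ≡ length ps
    kerCount-parametrised ps ps-unique f g Vf gf g∈ fg =
      trans (unique-≋⇒length-≡ kernel-unique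
        (unique-map (λ p∈ r∈ eq → trans (sym (gf p∈)) (trans (cong g eq) (gf r∈))) ps-unique)
        (λ {b} b∈ → subst (_∈ map f ps) (fg (kernel⇒Vanishes b∈)) (∈-map⁺ f (g∈ (kernel⇒Vanishes b∈))))
        from) (length-map f ps)
      where
      from : ∀ {b} → b ∈ map f ps → b ∈ kernel
      from b∈ with ∈-map⁻ f b∈
      ... | p , p∈ , refl = ∈-kernel (Vf p∈)

    module _ {x : Carrier} {ts : List Carrier} (x∷ts∈U : All U (x ∷ ts)) (x≢0 : x ≢ 0#)
      (spanning : ∀ {v} → U v → Span (x ∷ ts) v) where

      private
        i = inv x≢0

        x⊗[i⊗t] : ∀ t → x ⊗ (i ⊗ t) ≡ t
        x⊗[i⊗t] t = trans (sym (*-assoc x i t)) (trans (cong (_⊗ t) (inv-inverseʳ x≢0)) (*-identityˡ t))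

      -- What is left for (b₁ , b₂) after rescaling by x and eliminating b₀: `δ x≢0 t` is σ y - y at
      -- y = x⁻¹ t.
      Invariant : Carrier × Carrier → Set
      Invariant b = ∀ {t} → t ∈ ts → Fixed (G (δ x≢0 t) b)

      Vanishes⇒Invariant : ∀ b → Vanishes b → let b′ = twist x b in
        proj₁ b′ ≡ b₀-of (proj₂ b′) × Invariant (proj₂ b′)
      Vanishes⇒Invariant b V = x⊝y≡0⇒x≡y (trans (sym (F-at-1 b₀ b₁ b₂)) at-1) , invariant
        where
        b′ = twist x b
        b₀ = proj₁ b′
        b₁ = proj₁ (proj₂ b′)
        b₂ = proj₂ (proj₂ b′)
        at : ∀ t {y} → x ⊗ t ≡ y → U y → F b′ t ≡ 0#
        at t refl Uy = trans (F-twist x b t) (trans (cong (_⊗ x) (V Uy)) (zeroˡ x))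
        at-1 : F b′ 1# ≡ 0#
        at-1 = at 1# (*-identityʳ x) (All.lookup x∷ts∈U (here refl))
        invariant : Invariant (proj₂ b′)
        invariant {t} t∈ = τ-invariant⇒fixed (begin
          g ⊝ τ g                          ≡⟨ +-identityˡ _ ⟨
          0# ⊕ (g ⊝ τ g)                   ≡⟨ cong (_⊕ (g ⊝ τ g)) (trans (cong ((i ⊗ t) ⊗_) at-1) (zeroʳ _)) ⟨
          (i ⊗ t) ⊗ F b′ 1# ⊕ (g ⊝ τ g)    ≡⟨ F-G b₀ b₁ b₂ (i ⊗ t) ⟨
          F b′ (i ⊗ t)                     ≡⟨ at (i ⊗ t) (x⊗[i⊗t] t) (All.lookup x∷ts∈U (there t∈)) ⟩
          0#                               ∎)
          where g = G (δ x≢0 t) (b₁ , b₂)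

      Invariant⇒Vanishes : ∀ b → Invariant b → Vanishes (twist i (b₀-of b , b))
      Invariant⇒Vanishes b@(b₁ , b₂) inv-b Uv = F-span (twist i b′) roots (spanning Uv)
        where
        b′ = b₀-of b , b
        at-1 : F b′ 1# ≡ 0#
        at-1 = trans (F-at-1 (b₀-of b) b₁ b₂) (-‿inverseʳ _)
        roots : ∀ {t} → t ∈ x ∷ ts → F (twist i b′) t ≡ 0#
        roots {t} (here refl) = trans (F-twist i b′ t)
          (trans (cong (_⊗ i) (trans (cong (F b′) (inv-inverseˡ x≢0)) at-1)) (zeroˡ i))
        roots {t} (there t∈) = trans (F-twist i b′ t) (trans (cong (_⊗ i) (begin
          F b′ (i ⊗ t)                     ≡⟨ F-G (b₀-of b) b₁ b₂ (i ⊗ t) ⟩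
          (i ⊗ t) ⊗ F b′ 1# ⊕ (g ⊝ τ g)    ≡⟨ cong₂ _⊕_ (trans (cong ((i ⊗ t) ⊗_) at-1) (zeroʳ _)) (x≡y⇒x⊝y≡0 (sym (fixed-τ (inv-b t∈)))) ⟩
          0# ⊕ 0#                          ≡⟨ +-identityˡ 0# ⟩
          0#                               ∎)) (zeroˡ i))
          where g = G (δ x≢0 t) (b₁ , b₂)

      kerCount-invariant : ∀ {P : Set} (ps : List P) → Unique ps →
        (f : P → Carrier × Carrier) (g : Carrier × Carrier → P) →
        (∀ {p} → p ∈ ps → Invariant (f p)) → (∀ {p} → p ∈ ps → g (f p) ≡ p) →
        (∀ {b} → Invariant b → g b ∈ ps) → (∀ {b} → Invariant b → f (g b) ≡ b) →
        kerCount K s W ≡ length ps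
      kerCount-invariant ps ps-unique f g If gf g∈ fg =
        kerCount-parametrised ps ps-unique (λ p → twist i (b₀-of (f p) , f p)) (λ b → g (proj₂ (twist x b)))
          (λ {p} p∈ → Invariant⇒Vanishes (f p) (If p∈))
          (λ {p} p∈ → trans (cong (g ∘ proj₂) (twist-inverse (inv-inverseʳ x≢0) (b₀-of (f p) , f p))) (gf p∈))
          (λ {b} V → g∈ (proj₂ (Vanishes⇒Invariant b V)))
          (λ {b} V → let eq , I = Vanishes⇒Invariant b V in begin
            twist i (b₀-of (f (g (proj₂ (twist x b)))) , f (g (proj₂ (twist x b)))) ≡⟨ cong (λ z → twist i (b₀-of z , z)) (fg I) ⟩
            twist i (b₀-of (proj₂ (twist x b)) , proj₂ (twist x b)) ≡⟨ cong (λ z → twist i (z , proj₂ (twist x b))) eq ⟨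
            twist i (twist x b) ≡⟨ twist-inverse (inv-inverseˡ x≢0) b ⟩
            b ∎)

    kerCount-0 : (∀ {v} → U v → Span [] v) → kerCount K s W ≡ q ^ n * (q ^ n * q ^ n)
    kerCount-0 spanning = trans
      (kerCount-parametrised triples
        (Uniqueₚ.cartesianProduct⁺ elems-unique (Uniqueₚ.cartesianProduct⁺ elems-unique elems-unique))
        (λ b → b) (λ b → b) (λ {b} _ Uv → F-span b (λ ()) (spanning Uv)) (λ _ → refl)
        (λ _ → ∈-cartesianProduct⁺ (∈-elems _) (∈-cartesianProduct⁺ (∈-elems _) (∈-elems _))) (λ _ → refl))
      (trans (length-cartesianProduct elems (cartesianProduct elems elems))
        (cong₂ _*_ length-elems (trans (length-cartesianProduct elems elems) (cong₂ _*_ length-elems length-elems))))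

    kerCount-1 : ∀ {x} → All U (x ∷ []) → Independent (x ∷ []) → (∀ {v} → U v → Span (x ∷ []) v) →
      kerCount K s W ≡ q ^ n * q ^ n
    kerCount-1 xs∈U ind spanning = trans
      (kerCount-invariant xs∈U (independent-head-≢0 ind) spanning (cartesianProduct elems elems)
        (Uniqueₚ.cartesianProduct⁺ elems-unique elems-unique) (λ b → b) (λ b → b)
        (λ _ ()) (λ _ → refl) (λ _ → ∈-cartesianProduct⁺ (∈-elems _) (∈-elems _)) (λ _ → refl))
      (trans (length-cartesianProduct elems elems) (cong₂ _*_ length-elems length-elems))

    -- The scalar c = G Y b and the field element b₂ are arbitrary, and they determine b₁ because Y
    -- ≠ 0.
    kerCount-2 : ∀ {x y} → All U (x ∷ y ∷ []) → Independent (x ∷ y ∷ []) →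
      (∀ {v} → U v → Span (x ∷ y ∷ []) v) → kerCount K s W ≡ q * q ^ n
    kerCount-2 {x} {y} xs∈U ind spanning = trans
      (kerCount-invariant xs∈U x≢0 spanning (cartesianProduct Fq elems)
        (Uniqueₚ.cartesianProduct⁺ Fq-unique elems-unique)
        (λ { (c , b₂) → b₁-of Y≢0 c b₂ , b₂ }) (λ { b@(b₁ , b₂) → G Y b , b₂ })
        (λ { {c , b₂} p∈ (here refl) → subst Fixed (sym (G-b₁-of Y≢0 c b₂))
          (InFq⇒fixed (Fq⇒InFq (proj₁ (∈-cartesianProduct⁻ Fq elems p∈)))) })
        (λ { {c , b₂} _ → cong (_, b₂) (G-b₁-of Y≢0 c b₂) })
        (λ I → ∈-cartesianProduct⁺ (∈-Fq (fixed⇒InFq (I (here refl)))) (∈-elems _))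
        (λ { {b₁ , b₂} _ → cong (_, b₂) (b₁-of-G Y≢0 b₁ b₂) }))
      (trans (length-cartesianProduct Fq elems) (cong₂ _*_ ∣Fq∣≡q length-elems))
      where
      x≢0 = independent-head-≢0 ind
      Y = δ x≢0 y
      Y≢0 : Y ≢ 0#
      Y≢0 = independent-head-≢0 (independent-map-δ x≢0 (y ∷ []) ind)

    -- Eliminating b₁ between c = G Y b and d = G Z b leaves (1 − τ)(b₂ E) = c Z − d Y = (σ − 1)(c z′ − d y′),
    -- so b₂ E = σ (c z′ − d y′) + e with e fixed, and (c , d , e) parametrises the kernel.
    kerCount-3 : ∀ {x y z} → All U (x ∷ y ∷ z ∷ []) → Independent (x ∷ y ∷ z ∷ []) →
      (∀ {v} → U v → Span (x ∷ y ∷ z ∷ []) v) → kerCount K s W ≡ q * (q * q)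
    kerCount-3 {x} {y} {z} xs∈U ind spanning = trans
      (kerCount-invariant xs∈U x≢0 spanning (cartesianProduct Fq (cartesianProduct Fq Fq))
        (Uniqueₚ.cartesianProduct⁺ Fq-unique (Uniqueₚ.cartesianProduct⁺ Fq-unique Fq-unique))
        f g f-invariant gf g∈ fg)
      (trans (length-cartesianProduct Fq (cartesianProduct Fq Fq))
        (cong₂ _*_ ∣Fq∣≡q (trans (length-cartesianProduct Fq Fq) (cong₂ _*_ ∣Fq∣≡q ∣Fq∣≡q))))
      where
      x≢0 = independent-head-≢0 ind
      y′ = inv x≢0 ⊗ y
      z′ = inv x≢0 ⊗ z
      Y = δ x≢0 y
      Z = δ x≢0 z
      ind′ : Independent (Y ∷ Z ∷ [])
      ind′ = independent-map-δ x≢0 (y ∷ z ∷ []) ind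
      Y≢0 : Y ≢ 0#
      Y≢0 = independent-head-≢0 ind′
      E = Z ⊗ σ Y ⊝ Y ⊗ σ Z
      E≢0 : E ≢ 0#
      E≢0 = wronskian-≢0 ind′

      w : Carrier → Carrier → Carrier
      w c d = c ⊗ z′ ⊝ d ⊗ y′

      w-difference : ∀ {c d} → Fixed c → Fixed d → σ (w c d) ⊝ w c d ≡ c ⊗ Z ⊝ d ⊗ Y
      w-difference {c} {d} fc fd = trans
        (cong (_⊝ w c d) (trans (σ-⊝ _ _) (cong₂ _⊝_
          (trans (σ-⊗ c z′) (cong (_⊗ σ z′) fc)) (trans (σ-⊗ d y′) (cong (_⊗ σ y′) fd)))))
        (solve 6 (λ c d z y sz sy → (c :* sz :- d :* sy) :- (c :* z :- d :* y)
          := c :* (sz :- z) :- d :* (sy :- y)) refl c d z′ y′ (σ z′) (σ y′))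

      -- The terms with b₁ and those with Y Z cancel; what remains has coefficient E at b₂ and -τ E
      -- at τ b₂.
      elimination : ∀ b₁ b₂ → Z ⊗ G Y (b₁ , b₂) ⊝ Y ⊗ G Z (b₁ , b₂) ≡ b₂ ⊗ E ⊝ τ (b₂ ⊗ E)
      elimination b₁ b₂ = begin
        Z ⊗ G Y (b₁ , b₂) ⊝ Y ⊗ G Z (b₁ , b₂)
          ≡⟨ solve 9 (λ Y Z P Q R S b₁ b₂ t →
               Z :* (b₁ :* Y :+ (b₂ :* (P :+ Y) :+ t :* (Y :+ R))) :- Y :* (b₁ :* Z :+ (b₂ :* (Q :+ Z) :+ t :* (Z :+ S)))
               := b₂ :* (Z :* P :- Y :* Q) :- t :* (S :* Y :- R :* Z)) refl Y Z (σ Y) (σ Z) (τ Y) (τ Z) b₁ b₂ (τ b₂) ⟩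
        b₂ ⊗ E ⊝ τ b₂ ⊗ (τ Z ⊗ Y ⊝ τ Y ⊗ Z)
          ≡⟨ cong (λ v → b₂ ⊗ E ⊝ τ b₂ ⊗ v) τE ⟨
        b₂ ⊗ E ⊝ τ b₂ ⊗ τ E
          ≡⟨ cong (b₂ ⊗ E ⊝_) (τ-⊗ b₂ E) ⟨
        b₂ ⊗ E ⊝ τ (b₂ ⊗ E) ∎
        where
        τE : τ E ≡ τ Z ⊗ Y ⊝ τ Y ⊗ Z
        τE = trans (τ-⊝ _ _) (cong₂ _⊝_ (trans (τ-⊗ Z (σ Y)) (cong (τ Z ⊗_) (τσ Y)))
          (trans (τ-⊗ Y (σ Z)) (cong (τ Y ⊗_) (τσ Z))))

      b₂-of : Carrier × Carrier × Carrier → Carrier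
      b₂-of (c , d , e) = (σ (w c d) ⊕ e) ⊗ inv E≢0

      b₂-of-E : ∀ c d e → b₂-of (c , d , e) ⊗ E ≡ σ (w c d) ⊕ e
      b₂-of-E c d e = trans (*-assoc _ _ _) (trans (cong ((σ (w c d) ⊕ e) ⊗_) (inv-inverseˡ E≢0)) (*-identityʳ _))

      f : Carrier × Carrier × Carrier → Carrier × Carrier
      f p@(c , _) = b₁-of Y≢0 c (b₂-of p) , b₂-of p

      g : Carrier × Carrier → Carrier × Carrier × Carrier
      g b@(_ , b₂) = G Y b , G Z b , b₂ ⊗ E ⊝ σ (w (G Y b) (G Z b))

      scalars : ∀ {c d e} → (c , d , e) ∈ cartesianProduct Fq (cartesianProduct Fq Fq) → Fixed c × Fixed d × Fixed e
      scalars p∈ with ∈-cartesianProduct⁻ Fq (cartesianProduct Fq Fq) p∈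
      ... | c∈ , de∈ with ∈-cartesianProduct⁻ Fq Fq de∈
      ...   | d∈ , e∈ = InFq⇒fixed (Fq⇒InFq c∈) , InFq⇒fixed (Fq⇒InFq d∈) , InFq⇒fixed (Fq⇒InFq e∈)

      G-Y-f : ∀ p → G Y (f p) ≡ proj₁ p
      G-Y-f p@(c , _) = G-b₁-of Y≢0 c (b₂-of p)

      -- Only G Y is prescribed through b₁. With v = `w c d`, elimination gives c Z - Y (G Z) = (1 -
      -- τ)(σ v + e) = σ v - v = c Z - d Y, which forces G Z = d.
      G-Z-f : ∀ {c d e} → Fixed c → Fixed d → Fixed e → G Z (f (c , d , e)) ≡ d
      G-Z-f {c} {d} {e} fc fd fe = ⊗-cancelˡ Y≢0 (begin
        Y ⊗ G Z b                                  ≡⟨ solve 2 (λ a b → b := a :- (a :- b)) refl (Z ⊗ c) (Y ⊗ G Z b) ⟩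
        Z ⊗ c ⊝ (Z ⊗ c ⊝ Y ⊗ G Z b)                ≡⟨ cong (λ v → Z ⊗ c ⊝ (Z ⊗ v ⊝ Y ⊗ G Z b)) (G-Y-f p) ⟨
        Z ⊗ c ⊝ (Z ⊗ G Y b ⊝ Y ⊗ G Z b)            ≡⟨ cong (Z ⊗ c ⊝_) (elimination (proj₁ b) (b₂-of p)) ⟩
        Z ⊗ c ⊝ (b₂-of p ⊗ E ⊝ τ (b₂-of p ⊗ E))    ≡⟨ cong (λ v → Z ⊗ c ⊝ (v ⊝ τ v)) (b₂-of-E c d e) ⟩
        Z ⊗ c ⊝ (σ v ⊕ e ⊝ τ (σ v ⊕ e))            ≡⟨ cong (λ t → Z ⊗ c ⊝ (σ v ⊕ e ⊝ t)) (trans (τ-⊕ _ _) (cong₂ _⊕_ (τσ v) (fixed-τ fe))) ⟩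
        Z ⊗ c ⊝ (σ v ⊕ e ⊝ (v ⊕ e))                ≡⟨ cong (Z ⊗ c ⊝_) (solve 3 (λ s e v → s :+ e :- (v :+ e) := s :- v) refl (σ v) e v) ⟩
        Z ⊗ c ⊝ (σ v ⊝ v)                          ≡⟨ cong (Z ⊗ c ⊝_) (w-difference fc fd) ⟩
        Z ⊗ c ⊝ (c ⊗ Z ⊝ d ⊗ Y)                    ≡⟨ solve 4 (λ c d Y Z → Z :* c :- (c :* Z :- d :* Y) := Y :* d) refl c d Y Z ⟩
        Y ⊗ d                                      ∎)
        where
        p = c , d , e
        b = f p
        v = w c d

      f-invariant : ∀ {p} → p ∈ cartesianProduct Fq (cartesianProduct Fq Fq) →
        ∀ {t} → t ∈ y ∷ z ∷ [] → Fixed (G (δ x≢0 t) (f p))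
      f-invariant {p} p∈ (here refl) = subst Fixed (sym (G-Y-f p)) (proj₁ (scalars p∈))
      f-invariant p∈ (there (here refl)) with scalars p∈
      ... | fc , fd , fe = subst Fixed (sym (G-Z-f fc fd fe)) fd

      gf : ∀ {p} → p ∈ cartesianProduct Fq (cartesianProduct Fq Fq) → g (f p) ≡ p
      gf {p@(c , d , e)} p∈ with scalars p∈
      ... | fc , fd , fe = cong₂ _,_ (G-Y-f p) (cong₂ _,_ (G-Z-f fc fd fe) (begin
        b₂-of p ⊗ E ⊝ σ (w (G Y (f p)) (G Z (f p)))  ≡⟨ cong₂ (λ s t → b₂-of p ⊗ E ⊝ σ (w s t)) (G-Y-f p) (G-Z-f fc fd fe) ⟩
        b₂-of p ⊗ E ⊝ σ (w c d)                      ≡⟨ cong (_⊝ σ (w c d)) (b₂-of-E c d e) ⟩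
        σ (w c d) ⊕ e ⊝ σ (w c d)                    ≡⟨ solve 2 (λ s e → s :+ e :- s := e) refl (σ (w c d)) e ⟩
        e                                            ∎))

      -- The third coordinate is a scalar because (1 - τ)(b₂ E) and (1 - τ)(σ v) = σ v - v are both
      -- c Z - d Y.
      g∈ : ∀ {b} → (∀ {t} → t ∈ y ∷ z ∷ [] → Fixed (G (δ x≢0 t) b)) → g b ∈ cartesianProduct Fq (cartesianProduct Fq Fq)
      g∈ {b@(b₁ , b₂)} I = ∈-cartesianProduct⁺ (∈-Fq (fixed⇒InFq fc))
        (∈-cartesianProduct⁺ (∈-Fq (fixed⇒InFq fd)) (∈-Fq (fixed⇒InFq (τ-invariant⇒fixed (begin
          (b₂ ⊗ E ⊝ σ v) ⊝ τ (b₂ ⊗ E ⊝ σ v)      ≡⟨ cong (b₂ ⊗ E ⊝ σ v ⊝_) (trans (τ-⊝ _ _) (cong (τ (b₂ ⊗ E) ⊝_) (τσ v))) ⟩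
          (b₂ ⊗ E ⊝ σ v) ⊝ (τ (b₂ ⊗ E) ⊝ v)      ≡⟨ solve 4 (λ a s t v → (a :- s) :- (t :- v) := (a :- t) :- (s :- v)) refl (b₂ ⊗ E) (σ v) (τ (b₂ ⊗ E)) v ⟩
          (b₂ ⊗ E ⊝ τ (b₂ ⊗ E)) ⊝ (σ v ⊝ v)      ≡⟨ cong₂ _⊝_ (elimination b₁ b₂) (sym (w-difference fc fd)) ⟨
          (Z ⊗ c ⊝ Y ⊗ d) ⊝ (c ⊗ Z ⊝ d ⊗ Y)      ≡⟨ x≡y⇒x⊝y≡0 (cong₂ _⊝_ (*-comm Z c) (*-comm Y d)) ⟩
          0#                                     ∎)))))
        where
        c = G Y b
        d = G Z b
        v = w c d
        fc : Fixed c
        fc = I (here refl)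
        fd : Fixed d
        fd = I (there (here refl))

      fg : ∀ {b} → (∀ {t} → t ∈ y ∷ z ∷ [] → Fixed (G (δ x≢0 t) b)) → f (g b) ≡ b
      fg {b@(b₁ , b₂)} _ = trans (cong (λ v → b₁-of Y≢0 (G Y b) v , v) b₂≡) (cong (_, b₂) (b₁-of-G Y≢0 b₁ b₂))
        where
        b₂≡ : b₂-of (g b) ≡ b₂
        b₂≡ = begin
          (σ v ⊕ (b₂ ⊗ E ⊝ σ v)) ⊗ inv E≢0  ≡⟨ cong (_⊗ inv E≢0) (solve 2 (λ s a → s :+ (a :- s) := a) refl (σ v) (b₂ ⊗ E)) ⟩
          b₂ ⊗ E ⊗ inv E≢0                  ≡⟨ trans (*-assoc _ _ _) (trans (cong (b₂ ⊗_) (inv-inverseʳ E≢0)) (*-identityʳ b₂)) ⟩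
          b₂                                ∎
          where v = w (G Y b) (G Z b)

    kerCount-trivial : (∀ {b} → Vanishes b → b ≡ 0-coeffs) → kerCount K s W ≡ 1
    kerCount-trivial trivial = kerCount-parametrised (tt ∷ []) ([] ∷ []) (λ _ → 0-coeffs) (λ _ → tt)
      (λ _ {x} _ → F-0-coeffs x) (λ _ → refl) (λ _ → here refl) (λ V → sym (trivial V))

    kerCount-5 : ∀ xs → length xs ≡ 5 → All U xs → Independent xs → kerCount K s W ≡ 1
    kerCount-5 xs ∣xs∣ xs∈U ind = kerCount-trivial trivial
      where
      trivial : ∀ {b} → Vanishes b → b ≡ 0-coeffs
      trivial {b} V = conclude (too-many-roots 5 (F-coefficients b) xs refl ∣xs∣ ind
        (λ {x} x∈ → trans (evalσ-F b x) (trans (cong (σ ∘ σ) (V (All.lookup xs∈U x∈))) (trans (cong σ σ-0) σ-0))))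
        where
        conclude : All (_≡ 0#) (F-coefficients b) → b ≡ 0-coeffs
        conclude (b₂≡0 ∷ _ ∷ σσb₀≡0 ∷ σσb₁≡0 ∷ _) = cong₂ _,_ (σσ≡0 σσb₀≡0) (cong₂ _,_ (σσ≡0 σσb₁≡0) b₂≡0)

    -- Four independent roots

    module _ (σσ-fixed : ∀ {x} → σ (σ x) ≡ x → Fixed x)
      {xs : List Carrier} (∣xs∣ : length xs ≡ 4) (xs∈U : All U xs) (ind : Independent xs) where

      -- If d cancels the leading coefficients, σ² F b − d σ² F a has only four coefficients.
      leading-determines : ∀ {a₀ a₁ a₂ b₀ b₁ b₂} d → Vanishes (a₀ , a₁ , a₂) → Vanishes (b₀ , b₁ , b₂) →
        σ (σ b₂) ≡ d ⊗ σ (σ a₂) →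
        b₂ ≡ d ⊗ a₂ × σ (σ b₀) ≡ d ⊗ σ (σ a₀) × σ (σ b₁) ≡ d ⊗ σ (σ a₁)
      leading-determines {a₀} {a₁} {a₂} {b₀} {b₁} {b₂} d Va Vb lead =
        conclude (too-many-roots 4 cs xs refl ∣xs∣ ind root)
        where
        a = a₀ , a₁ , a₂
        b = b₀ , b₁ , b₂
        cs = b₂ ⊝ d ⊗ a₂ ∷ σ b₁ ⊝ d ⊗ σ a₁ ∷ σ (σ b₀) ⊝ d ⊗ σ (σ a₀) ∷ σ (σ b₁) ⊝ d ⊗ σ (σ a₁) ∷ []
        σσF≡0 : ∀ {c x} → Vanishes c → x ∈ xs → evalσ (F-coefficients c) x ≡ 0#
        σσF≡0 {c} {x} V x∈ = trans (evalσ-F c x)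
          (trans (cong (σ ∘ σ) (V (All.lookup xs∈U x∈))) (trans (cong σ σ-0) σ-0))
        root : ∀ {x} → x ∈ xs → evalσ cs x ≡ 0#
        root {x} x∈ = begin
          evalσ cs x
            ≡⟨ evalσ-append-0 cs x ⟨
          -- `cs` has one entry fewer than the difference of the two coefficient lists; the missing
          -- last entry is zero by `lead`.
          evalσ (cs ++ 0# ∷ []) x
            ≡⟨ cong (λ v → evalσ (cs ++ v ∷ []) x) (x≡y⇒x⊝y≡0 lead) ⟨
          evalσ (zipWith (λ u v → u ⊝ d ⊗ v) (F-coefficients b) (F-coefficients a)) x
            ≡⟨ evalσ-zipWith d (F-coefficients b) (F-coefficients a) refl x ⟩
          evalσ (F-coefficients b) x ⊝ d ⊗ evalσ (F-coefficients a) x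
            ≡⟨ cong₂ (λ u v → u ⊝ d ⊗ v) (σσF≡0 Vb x∈) (σσF≡0 Va x∈) ⟩
          0# ⊝ d ⊗ 0#
            ≡⟨ x≡y⇒x⊝y≡0 (sym (zeroʳ d)) ⟩
          0# ∎
        conclude : All (_≡ 0#) cs → b₂ ≡ d ⊗ a₂ × σ (σ b₀) ≡ d ⊗ σ (σ a₀) × σ (σ b₁) ≡ d ⊗ σ (σ a₁)
        conclude (p ∷ _ ∷ r ∷ t ∷ []) = x⊝y≡0⇒x≡y p , x⊝y≡0⇒x≡y r , x⊝y≡0⇒x≡y t

      module _ {a₀ a₁ a₂ : Carrier} (Va : Vanishes (a₀ , a₁ , a₂)) (a≢0 : (a₀ , a₁ , a₂) ≢ 0-coeffs) where

        -- The polynomial is compared with itself at d = 0: without a leading coefficient it has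
        -- only four coefficients, and four independent roots make it zero.
        a₂≢0 : a₂ ≢ 0#
        a₂≢0 a₂≡0 = a≢0 (conclude (leading-determines 0# Va Va
          (trans (cong (σ ∘ σ) a₂≡0) (trans (cong σ σ-0) (trans σ-0 (sym (zeroˡ _)))))))
          where
          conclude : a₂ ≡ 0# ⊗ a₂ × σ (σ a₀) ≡ 0# ⊗ σ (σ a₀) × σ (σ a₁) ≡ 0# ⊗ σ (σ a₁) → (a₀ , a₁ , a₂) ≡ 0-coeffs
          conclude (_ , p₀ , p₁) = cong₂ _,_ (σσ≡0 (trans p₀ (zeroˡ _))) (cong₂ _,_ (σσ≡0 (trans p₁ (zeroˡ _))) a₂≡0)

        scale : Carrier → Coeffs
        scale c = c ⊗ a₀ , c ⊗ a₁ , c ⊗ a₂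

        ratio : Coeffs → Carrier
        ratio (_ , _ , b₂) = b₂ ⊗ inv a₂≢0

        -- The leading and the constant coefficient of σ² F a are σ² a₂ and a₂, whence σ² c = c.
        multiple : ∀ b → Vanishes b → Fixed (ratio b) × scale (ratio b) ≡ b
        multiple b@(b₀ , b₁ , b₂) Vb = conclude (leading-determines (σ (σ c)) Va Vb
          (trans (cong (σ ∘ σ) (sym ca₂≡b₂)) (trans (cong σ (σ-⊗ c a₂)) (σ-⊗ (σ c) (σ a₂)))))
          where
          c = ratio b
          ca₂≡b₂ : c ⊗ a₂ ≡ b₂
          ca₂≡b₂ = trans (*-assoc _ _ _) (trans (cong (b₂ ⊗_) (inv-inverseˡ a₂≢0)) (*-identityʳ b₂))
          conclude : b₂ ≡ σ (σ c) ⊗ a₂ × σ (σ b₀) ≡ σ (σ c) ⊗ σ (σ a₀) × σ (σ b₁) ≡ σ (σ c) ⊗ σ (σ a₁) →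
            Fixed c × scale c ≡ b
          conclude (p₂ , p₀ , p₁) =
            σσ-fixed (⊗-cancelˡ a₂≢0 (trans (*-comm _ _) (trans (sym p₂) (trans (sym ca₂≡b₂) (*-comm _ _))))) ,
            cong₂ _,_ (sym (σσ-cancel p₀)) (cong₂ _,_ (sym (σσ-cancel p₁)) ca₂≡b₂)

        kerCount-multiples : kerCount K s W ≡ q
        kerCount-multiples = trans
          (kerCount-parametrised Fq Fq-unique scale ratio
            (λ {c} c∈ {x} Ux → trans (F-scale (a₀ , a₁ , a₂) x (InFq⇒fixed (Fq⇒InFq c∈))) (trans (cong (c ⊗_) (Va Ux)) (zeroʳ c)))
            (λ {c} _ → trans (*-assoc _ _ _) (trans (cong (c ⊗_) (inv-inverseʳ a₂≢0)) (*-identityʳ c)))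
            (λ {b} V → ∈-Fq (fixed⇒InFq (proj₁ (multiple b V)))) (λ {b} V → proj₂ (multiple b V)))
          ∣Fq∣≡q

      kerCount-4 : kerCount K s W ≡ 1 ⊎ kerCount K s W ≡ q
      -- The finite kernel list is searched for a nonzero element; if one exists, all others are its
      -- scalar multiples.
      kerCount-4 = conclude (⊆-or-outside (≡-dec _≟_ (≡-dec _≟_ _≟_)) kernel (0-coeffs ∷ []))
        where
        only : ∀ {b} → b ∈ 0-coeffs ∷ [] → b ≡ 0-coeffs
        only (here eq) = eq
        conclude : (∀ {b} → b ∈ kernel → b ∈ 0-coeffs ∷ []) ⊎ (∃[ b ] (b ∈ kernel × b ∉ 0-coeffs ∷ [])) →
          kerCount K s W ≡ 1 ⊎ kerCount K s W ≡ q
        conclude (inj₁ sub)            = inj₁ (kerCount-trivial (λ V → only (sub (∈-kernel V))))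
        conclude (inj₂ (a , a∈ , a∉)) = inj₂ (kerCount-multiples (kernel⇒Vanishes a∈) (a∉ ∘ here))

-- Powers of Frobenius and the resulting ranks

1<m^n : ∀ {m n} → 1 < m → 1 ≤ n → 1 < m ^ n
1<m^n {m} {suc n} 1<m _ = ℕₚ.<-≤-trans 1<m (ℕₚ.m≤m*n m (m ^ n) {{ℕₚ.m^n≢0 m n {{>-nonZero (ℕₚ.<-trans (s≤s z≤n) 1<m)}}}})

half : ∀ {a} b → a ≡ b * 2 → a / 2 ≡ b
half b refl = m*n/n≡m b 2

module FrobeniusPowers {q n : ℕ} (K : FiniteField q n) where

  open FieldTheory K
  open ≡-Reasoning

  frob-+ : ∀ a b x → frob (a + b) x ≡ frob b (frob a x)
  frob-+ a b x = trans (cong (pow x) (ℕₚ.^-distribˡ-+-* q a b)) (pow-* x (q ^ a) (q ^ b))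

  frob-⊗ : ∀ k x y → frob k (x ⊗ y) ≡ frob k x ⊗ frob k y
  frob-⊗ k x y = pow-⊗ x y (q ^ k)

  frob-fixed-* : ∀ {a x} → frob a x ≡ x → ∀ k → frob (k * a) x ≡ x
  frob-fixed-* {a} {x} eq zero    = *-identityʳ x
  frob-fixed-* {a} {x} eq (suc k) = trans (frob-+ a (k * a) x) (trans (cong (frob (k * a)) eq) (frob-fixed-* eq k))

  InFq⇒frob-fixed : ∀ {x} → InFq x → ∀ k → frob k x ≡ x
  InFq⇒frob-fixed {x} h k = subst (λ j → frob j x ≡ x) (ℕₚ.*-identityʳ k)
    (frob-fixed-* {1} (trans (cong (pow x) (ℕₚ.*-identityʳ q)) h) k)

  -- By Bézout a multiple of s and a multiple of n differ by 1, and x is fixed by both Frobenius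
  -- powers. Over ℕ either multiple may be the larger one, hence two cases.
  frob-fixed⇒InFq : ∀ {s x} → gcd s n ≡ 1 → frob s x ≡ x → InFq x
  frob-fixed⇒InFq {s} {x} gcd≡1 fx = subst (λ k → pow x k ≡ x) (ℕₚ.*-identityʳ q)
    (frob-1 (coprime-Bézout (gcd≡1⇒coprime {s} {n} gcd≡1)))
    where
    frob-1 : Bézout.Identity 1 s n → frob 1 x ≡ x
    frob-1 (Bézout.+- k l eq) = begin
      frob 1 x                   ≡⟨ cong (frob 1) (frob-fixed-* (frob-n x) l) ⟨
      frob 1 (frob (l * n) x)    ≡⟨ frob-+ (l * n) 1 x ⟨
      frob (l * n + 1) x         ≡⟨ cong (λ j → frob j x) (trans (ℕₚ.+-comm (l * n) 1) eq) ⟩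
      frob (k * s) x             ≡⟨ frob-fixed-* fx k ⟩
      x                          ∎
    frob-1 (Bézout.-+ k l eq) = begin
      frob 1 x                   ≡⟨ cong (frob 1) (frob-fixed-* fx k) ⟨
      frob 1 (frob (k * s) x)    ≡⟨ frob-+ (k * s) 1 x ⟨
      frob (k * s + 1) x         ≡⟨ cong (λ j → frob j x) (trans (ℕₚ.+-comm (k * s) 1) eq) ⟩
      frob (l * n) x             ≡⟨ frob-fixed-* (frob-n x) l ⟩
      x                          ∎

  -- For odd n, s n is a multiple of 2s plus s, so the identity `frob (s * n)` acts on x as
  -- `frob s`.
  frob-square-fixed : n % 2 ≡ 1 → ∀ {s x} → frob s (frob s x) ≡ x → frob s x ≡ x
  frob-square-fixed odd {s} {x} eq = begin
    frob s x                              ≡⟨ cong (frob s) (frob-fixed-* {s + s} (trans (frob-+ s s x) eq) (n / 2)) ⟨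
    frob s (frob (n / 2 * (s + s)) x)     ≡⟨ frob-+ (n / 2 * (s + s)) s x ⟨
    frob (n / 2 * (s + s) + s) x          ≡⟨ cong (λ j → frob j x) exponent ⟩
    frob (s * n) x                        ≡⟨ frob-fixed-* (frob-n x) s ⟩
    x                                     ∎
    where
    arith : ∀ k s → k * (s + s) + s ≡ s * (1 + k * 2)
    arith = solve-∀
    exponent : n / 2 * (s + s) + s ≡ s * n
    exponent = begin
      n / 2 * (s + s) + s     ≡⟨ arith (n / 2) s ⟩
      s * (1 + n / 2 * 2)     ≡⟨ cong (λ r → s * (r + n / 2 * 2)) odd ⟨
      s * (n % 2 + n / 2 * 2) ≡⟨ cong (s *_) (m≡m%n+[m/n]*n n 2) ⟨
      s * n                   ∎

-- The degree is written as m + 2 so that n - 1 and n - 2 in the exponents of `polyS` compute to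
-- `suc m` and `m`.
module Rank {q m : ℕ} (K : FiniteField q (suc (suc m))) (s : ℕ)
  {p e : ℕ} (pp : Prime p) (1≤e : 1 ≤ e) (q≡p^e : q ≡ p ^ e)
  (odd : suc (suc m) % 2 ≡ 1) (gcd≡1 : gcd s (suc (suc m)) ≡ 1) where

  open FieldTheory K
  open ScalarField K
  open FrobeniusPowers K

  n : ℕ
  n = suc (suc m)

  frob-generator : GaloisGenerator K
  frob-generator = record
    { σ          = frob s
    -- Inverse to σ because s + s (n - 1) = s n and `frob n` is the identity.
    ; τ          = frob (s * suc m)
    ; σ-⊕        = frob-⊕ {e = e} pp q≡p^e s
    ; σ-⊗        = frob-⊗ s
    ; στ         = λ x → trans (sym (frob-+ (s * suc m) s x)) (frob-sn (ℕₚ.+-comm (s * suc m) s) x)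
    ; τσ         = λ x → trans (sym (frob-+ s (s * suc m) x)) (frob-sn refl x)
    ; InFq⇒fixed = λ h → InFq⇒frob-fixed h s
    ; fixed⇒InFq = frob-fixed⇒InFq {s} gcd≡1
    ; ∣Fq∣≡q     = length-Fq {k = q ∸ 2} (sym (ℕₚ.m+[n∸m]≡n 1<q)) refl
    ; 1<q        = 1<q
    }
    where
    1<q : 1 < q
    1<q = subst (1 <_) (sym q≡p^e) (1<m^n (nonTrivial⇒n>1 p {{prime⇒nonTrivial pp}}) 1≤e)
    frob-sn : ∀ {j} → j ≡ s + s * suc m → ∀ x → frob j x ≡ x
    frob-sn eq x = trans (cong (λ i → frob i x) (trans eq (sym (ℕₚ.*-suc s (suc m))))) (frob-fixed-* (frob-n x) s)

  open Kernel K frob-generator public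

  polyS≡F : ∀ b x → polyS K s b x ≡ F b x
  polyS≡F (b₀ , b₁ , b₂) x = cong₂ (λ u v → b₀ ⊗ x ⊕ u ⊕ v)
    (cong (λ j → b₁ ⊗ frob j x ⊕ τ (b₁ ⊗ x)) (ℕₚ.*-identityʳ s))
    (cong₂ (λ u v → b₂ ⊗ u ⊕ v)
      (trans (cong (λ j → frob j x) (trans (ℕₚ.*-suc s 1) (cong (s +_) (ℕₚ.*-identityʳ s)))) (frob-+ s s x))
      (ττ (b₂ ⊗ x)))
    where
    ττ : ∀ y → frob (s * m) y ≡ τ (τ y)
    ττ y = begin
      -- Replacing y by σ² τ² y lets one σ be absorbed: s m + s = s (n - 1) is the exponent of τ.
      frob (s * m) y                   ≡⟨ cong (frob (s * m)) (trans (cong σ (στ (τ y))) (στ y)) ⟨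
      frob (s * m) (σ (σ (τ (τ y))))   ≡⟨ frob-+ s (s * m) _ ⟨
      frob (s + s * m) (σ (τ (τ y)))   ≡⟨ cong (λ j → frob j (σ (τ (τ y)))) (ℕₚ.*-suc s m) ⟨
      τ (σ (τ (τ y)))                  ≡⟨ τσ (τ (τ y)) ⟩
      τ (τ y)                          ∎
      where open ≡-Reasoning

  Independents : ∀ {u} → Subspace K u → ℕ → Set
  Independents W k = ∃[ xs ] (length xs ≡ k × All (Subspace.U W) xs × Independent xs)

  rank-large : ∀ {u} (W : Subspace K u) → Independents W 5 → RankIs K s W (3 * n)
  rank-large W (xs , ∣xs∣ , xs∈U , ind) = 0 , kerCount-5 s polyS≡F W xs ∣xs∣ xs∈U ind , refl

  rank-4 : (W : Subspace K 4) → Independents W 4 → RankIs K s W (3 * n) ⊎ RankIs K s W (3 * n ∸ 1)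
  rank-4 W (xs , ∣xs∣ , xs∈U , ind) = conclude (kerCount-4 s polyS≡F W (frob-square-fixed odd {s}) ∣xs∣ xs∈U ind)
    where
    conclude : kerCount K s W ≡ 1 ⊎ kerCount K s W ≡ q → RankIs K s W (3 * n) ⊎ RankIs K s W (3 * n ∸ 1)
    conclude (inj₁ eq) = inj₁ (0 , eq , refl)
    conclude (inj₂ eq) = inj₂ (1 , trans eq (sym (ℕₚ.*-identityʳ q)) , refl)

  rank-0 : (W : Subspace K 0) → Independents W 0 → RankIs K s W 0
  rank-0 W ([] , ∣xs∣ , xs∈U , ind) =
    3 * n , trans (kerCount-0 s polyS≡F W (basis-spans W ∣xs∣ xs∈U ind)) powers , ℕₚ.+-identityʳ (3 * n)
    where
    powers : q ^ n * (q ^ n * q ^ n) ≡ q ^ (3 * n)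
    powers = sym (trans (ℕₚ.^-distribˡ-+-* q n (n + (n + 0))) (cong (q ^ n *_)
      (trans (cong (λ j → q ^ (n + j)) (ℕₚ.+-identityʳ n)) (ℕₚ.^-distribˡ-+-* q n n))))

  rank-1 : (W : Subspace K 1) → Independents W 1 → RankIs K s W n
  rank-1 W (x ∷ [] , ∣xs∣ , xs∈U , ind) =
    n + n , trans (kerCount-1 s polyS≡F W xs∈U ind (basis-spans W ∣xs∣ xs∈U ind)) (sym (ℕₚ.^-distribˡ-+-* q n n)) ,
    arith n
    where
    arith : ∀ n → n + n + n ≡ 3 * n
    arith = solve-∀

  rank-2 : (W : Subspace K 2) → Independents W 2 → RankIs K s W (2 * suc m + 1)
  rank-2 W (x ∷ y ∷ [] , ∣xs∣ , xs∈U , ind) =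
    -- The product q · q^n is `q ^ suc n` by computation; the rank `2 * suc m + 1` is 2n - 1.
    suc n , kerCount-2 s polyS≡F W xs∈U ind (basis-spans W ∣xs∣ xs∈U ind) ,
    arith m
    where
    arith : ∀ m → 3 + m + (2 * suc m + 1) ≡ 3 * (2 + m)
    arith = solve-∀

  rank-3 : (W : Subspace K 3) → Independents W 3 → RankIs K s W (3 * suc m)
  rank-3 W (x ∷ y ∷ z ∷ [] , ∣xs∣ , xs∈U , ind) =
    3 , trans (kerCount-3 s polyS≡F W xs∈U ind (basis-spans W ∣xs∣ xs∈U ind))
      (cong (λ t → q * (q * t)) (sym (ℕₚ.*-identityʳ q))) , sym (ℕₚ.*-suc 3 (suc m))

  -- For u = 1, 2, 3 the truncated quotient is removed by exhibiting its numerator as twice an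
  -- explicit number.
  rank-small : ∀ {u} (W : Subspace K u) → u < 4 → RankIs K s W ((u * (2 * n ∸ u + 1)) / 2)
  rank-small {0} W _ = rank-0 W (independent-in W 0 z≤n)
  rank-small {1} W _ = subst (RankIs K s W) (sym (half n 1∙[2n])) (rank-1 W (independent-in W 1 ℕₚ.≤-refl))
    where
    1∙[2n] : 1 * (2 * n ∸ 1 + 1) ≡ n * 2
    1∙[2n] = trans (ℕₚ.*-identityˡ _) (trans (ℕₚ.m∸n+n≡m {2 * n} {1} (s≤s z≤n)) (ℕₚ.*-comm 2 n))
  rank-small {2} W _ = subst (RankIs K s W) (sym (half (2 * suc m + 1) 2∙[2n-1])) (rank-2 W (independent-in W 2 ℕₚ.≤-refl))
    where
    2∙[2n-1] : 2 * (2 * n ∸ 2 + 1) ≡ (2 * suc m + 1) * 2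
    2∙[2n-1] = trans (ℕₚ.*-comm 2 (2 * n ∸ 2 + 1)) (cong (λ t → (t ∸ 2 + 1) * 2) (ℕₚ.*-suc 2 (suc m)))
  rank-small {3} W _ = subst (RankIs K s W) (sym (half (3 * suc m) 3∙[2n-2])) (rank-3 W (independent-in W 3 ℕₚ.≤-refl))
    where
    3∙[2n-2] : 3 * (2 * n ∸ 3 + 1) ≡ 3 * suc m * 2
    3∙[2n-2] = trans (cong (λ t → 3 * (t ∸ 3 + 1)) (double m)) (arith m)
      where
      double : ∀ m → 2 * (2 + m) ≡ 4 + 2 * m
      double = solve-∀
      arith : ∀ m → 3 * (1 + 2 * m + 1) ≡ 3 * suc m * 2
      arith = solve-∀
  rank-small {suc (suc (suc (suc u)))} W (s≤s (s≤s (s≤s (s≤s ()))))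

theorem3p17 : (q n s : ℕ) → IsPrimePower q → 7 ≤ n → n % 2 ≡ 1
    → 1 ≤ s → s ≤ n → gcd s n ≡ 1
    → (K : FiniteField q n) → (u : ℕ) → (W : Subspace K u)
    → (4 < u → RankIs K s W (3 * n))
    × (u < 4 → RankIs K s W ((u * (2 * n ∸ u + 1)) / 2))
    × (u ≡ 4 → RankIs K s W (3 * n) ⊎ RankIs K s W (3 * n ∸ 1))
theorem3p17 q (suc (suc m)) s (p , e , pp , 1≤e , q≡p^e) (s≤s (s≤s _)) odd _ _ gcd≡1 K u W =
  -- Since 4 < u means 5 ≤ u, five independent elements are available whatever u is, and they
  -- already force the kernel to be trivial.
  (λ 4<u → rank-large W (independent-in W 5 4<u)) ,
  rank-small W ,
  λ { refl → rank-4 W (independent-in W 4 ℕₚ.≤-refl) }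
  where open Rank K s pp 1≤e q≡p^e odd gcd≡1
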